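{- Let $D$ be a digraph of order $n\geq 7$ and let $k$ be an integer with $2\leq k\leq n$. Then: (i) $0\leq \lambda^p_k(D)+\lambda^p_k(D^c)\leq n-1$, and both bounds are sharp; (ii) $0\leq \lambda^p_k(D)\,\lambda^p_k(D^c)\leq \left\lfloor\left(\frac{n-1}{2}\right)^2\right\rfloor$, and both bounds are sharp.
   Context: Digraphs have no loops and no parallel arcs. The complement $D^c$ of $D$ has vertex set $V(D)$ and, for distinct $u,v$, contains the arc $uv$ if and only if $uv$ is not an arc of $D$. For $S\subseteq V(D)$ with $|S|\geq 2$ and $r\in S$, an $(S,r)$-path is a directed path $P$ starting at $r$ with $S\subseteq V(P)$. $\lambda^p_{S,r}(D)$ is the maximum number of pairwise arc-disjoint $(S,r)$-paths in $D$, and $\lambda^p_k(D)=\min\{\lambda^p_{S,r}(D)\mid S\subseteq V(D),|S|=k,r\in S\}$. A bound is sharp if some digraph (of the relevant order) attains it. -}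

module Defs where

open import Data.Nat using (ℕ; suc; _≤_)
open import Data.Bool using (Bool; true; false; not; if_then_else_; T)
open import Data.Fin using (Fin; _≟_)
open import Data.Fin.Subset using (Subset; _∈_; ∣_∣)
open import Data.List using (List; []; _∷_)
open import Data.List.Membership.Propositional using () renaming (_∈_ to _∈ₗ_; _∉_ to _∉ₗ_)
open import Data.List.Relation.Unary.Unique.Propositional using (Unique)
open import Data.List.Relation.Unary.Linked using (Linked)
open import Data.Product using (Σ; _×_; _,_; ∃)
open import Relation.Nullary using (¬_; does)
open import Relation.Nullary.Decidable using (dec-true)
open import Relation.Binary.PropositionalEquality using (_≡_; _≢_; refl)

-- A digraph on vertex set Fin n: arc relation as a Bool matrix, no loops.
-- (No parallel arcs is automatic: arc u v is a single Bool.)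
record Digraph (n : ℕ) : Set where
  field
    arc      : Fin n → Fin n → Bool
    loopless : ∀ v → arc v v ≡ false
open Digraph public

complement-loopless : ∀ {n} (A : Fin n → Fin n → Bool) (v : Fin n) →
  (if does (v ≟ v) then false else not (A v v)) ≡ false
complement-loopless A v rewrite dec-true (v ≟ v) refl = refl

_ᶜ : ∀ {n} → Digraph n → Digraph n
arc (D ᶜ) u v = if does (u ≟ v) then false else not (arc D u v)
loopless (D ᶜ) v = complement-loopless (arc D) v

IsPath : ∀ {n} → Digraph n → List (Fin n) → Set
IsPath D P = Unique P × Linked (λ u v → T (arc D u v)) P

arcs : ∀ {n} → List (Fin n) → List (Fin n × Fin n)
arcs [] = []
arcs (u ∷ []) = []
arcs (u ∷ v ∷ P) = (u , v) ∷ arcs (v ∷ P)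

ArcDisjoint : ∀ {n} → List (Fin n) → List (Fin n) → Set
ArcDisjoint P Q = ∀ a → a ∈ₗ arcs P → a ∉ₗ arcs Q

-- An (S,r)-path: a directed path starting at r (vertex list r ∷ rest) containing all of S.
-- We record the path by the list of vertices following r.
IsSRPath : ∀ {n} → Digraph n → Subset n → Fin n → List (Fin n) → Set
IsSRPath D S r rest = IsPath D (r ∷ rest) × (∀ v → v ∈ S → v ∈ₗ (r ∷ rest))

SRPacking : ∀ {n} → Digraph n → Subset n → Fin n → ℕ → Set
SRPacking D S r m =
  Σ (Fin m → List (Fin _)) λ Ps →
    (∀ i → IsSRPath D S r (Ps i)) ×
    (∀ i j → i ≢ j → ArcDisjoint (r ∷ Ps i) (r ∷ Ps j))

IsLambdaSR : ∀ {n} → Digraph n → Subset n → Fin n → ℕ → Set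
IsLambdaSR D S r m = SRPacking D S r m × (∀ m′ → SRPacking D S r m′ → m′ ≤ m)

IsLambdaK : ∀ {n} → Digraph n → ℕ → ℕ → Set
IsLambdaK {n} D k m =
  (Σ (Subset n) λ S → Σ (Fin n) λ r → ∣ S ∣ ≡ k × r ∈ S × IsLambdaSR D S r m) ×
  (∀ (S : Subset n) (r : Fin n) → ∣ S ∣ ≡ k → r ∈ S → ∀ m′ → IsLambdaSR D S r m′ → m ≤ m′)

{-# OPTIONS --safe #-}
-- Upper bounds: the first arcs of arc-disjoint (S,r)-paths lead to distinct vertices, and a vertex
-- is an out-neighbour of r in only one of D and Dᶜ; so the two packing numbers at one (S,r) add up
-- to at most n - 1.  The product bound is then AM-GM.
--
-- The value 0: let one vertex dominate all others and let there be no further arcs; then D and Dᶜ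
-- both have a sink, and a sink r admits no (S,r)-path.
--
-- The value n - 1: decompose the complete digraph into n - 1 Hamiltonian cycles (possible for
-- n ≥ 7 by Tillson's theorem) and let D be the union of a of them.  Cutting the cycles open at r
-- gives a paths in D and n - 1 - a paths in Dᶜ; a = ⌊(n - 1)/2⌋ also makes the product maximal.
--
-- Decompositions: for n = 2t + 1 take the 2t rotations of Walecki's zigzag cycle
-- ∞, 0, 1, -1, 2, -2, …, t on ℤ/2t ∪ {∞}.  For n = 2t + 2 choose in this decomposition a rainbow
-- Hamiltonian path, i.e. one containing exactly one arc p → q of every cycle; replacing each such
-- arc by p → w → q inserts a new vertex w into all cycles, and the path closed up through w is
-- the missing one.
module Submission where

open import Defs
open import Data.Nat using (ℕ; _+_; _*_; _∸_; _≤_)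
open import Data.Nat.DivMod using (_/_)
open import Data.Product using (Σ; _×_)
open import Relation.Binary.PropositionalEquality using (_≡_)

import Algebra.Solver.CommutativeMonoid as CMSolver
open import Data.Bool using (true; false; T; T?; not; if_then_else_; _∧_)
open import Data.Fin as Fin using (Fin; zero; suc; toℕ; fromℕ<; inject≤; finToFun; funToFin)
import Data.Fin.Properties as Finₚ
open import Data.Fin.Subset using (Subset; ∣_∣; inside; outside; _∈_; ⊤; ⁅_⁆)
import Data.Fin.Subset.Properties as Subₚ
open import Data.List using (List; []; _∷_; _++_; [_]; length; lookup; map; tabulate; allFin; cartesianProductWith; initLast; _∷ʳ′_)
import Data.List.Properties as Listₚ
open import Data.List.Membership.Propositional using () renaming (_∈_ to _∈ₗ_; _∉_ to _∉ₗ_)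
import Data.List.Membership.Propositional.Properties as ∈ₚ
import Data.List.Membership.DecPropositional as DecMem
open import Data.List.Relation.Binary.Permutation.Propositional using (_↭_; ↭⇒↭ₛ; ↭-refl; ↭-sym; ↭-trans; ↭-reflexive)
import Data.List.Relation.Binary.Permutation.Propositional.Properties as ↭ₚ
import Data.List.Relation.Binary.Permutation.Setoid.Properties as ↭ₛₚ
open import Data.List.Relation.Unary.All as All using (All; []; _∷_)
import Data.List.Relation.Unary.All.Properties as Allₚ
open import Data.List.Relation.Unary.AllPairs as AllPairs using ([]; _∷_)
open import Data.List.Relation.Unary.Any as Any using (here; there)
import Data.List.Relation.Unary.Any.Properties as Anyₚ
open import Data.List.Relation.Unary.Linked as Linked using (Linked; []; [-]; _∷_)
import Data.List.Relation.Unary.Linked.Properties as Linkedₚ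
open import Data.List.Relation.Unary.Unique.Propositional using (Unique)
import Data.List.Relation.Unary.Unique.DecPropositional as DecUnique
import Data.List.Relation.Unary.Unique.Propositional.Properties as Uniqueₚ
open import Data.Nat as ℕ using (zero; suc; _<_; _<ᵇ_; _^_; z≤n; s≤s; z<s; NonZero)
open import Data.Nat.Divisibility using (n∣m*n)
open import Data.Nat.DivMod using (_%_; m≡m%n+[m/n]*n; %-distribˡ-+; m%n%n≡m%n; [m+n]%n≡m%n; m<n⇒m%n≡m; m%n<n; m*n/n≡m; /-monoˡ-≤; +-distrib-/-∣ʳ)
import Data.Nat.Properties as ℕₚ
open import Data.Nat.Tactic.RingSolver using (solve-∀)
open import Data.Product using (_,_; ∃; ∃₂; proj₁; proj₂; uncurry)
import Data.Product.Properties as ×ₚ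
open import Data.Sum using (_⊎_; inj₁; inj₂)
open import Data.Vec using ([]; _∷_; here; there)
open import Function using (_∘_)
open import Relation.Binary.Definitions using (tri<; tri≈; tri>)
open import Relation.Binary.PropositionalEquality using (_≢_; refl; sym; trans; cong; cong₂; subst; subst₂; setoid; module ≡-Reasoning)
open import Relation.Nullary using (¬_; Dec; yes; no; contradiction; does)
open import Relation.Nullary.Decidable using (map′; _×-dec_; _→-dec_; ¬?; decidable-stable; dec-true; dec-false)
open import Relation.Unary using (Decidable)

private variable
  X Y : Set
  R   : X → X → Set
  n   : ℕ

-- Packings of (S,r)-paths

lookup-injective : {xs : List X} → Unique xs → ∀ i j → lookup xs i ≡ lookup xs j → i ≡ j
lookup-injective (_ ∷ _)  zero    zero    _  = refl
lookup-injective (x∉ ∷ _) zero    (suc j) eq = contradiction eq (All.lookup x∉ (∈ₚ.∈-lookup j))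
lookup-injective (x∉ ∷ _) (suc i) zero    eq = contradiction (sym eq) (All.lookup x∉ (∈ₚ.∈-lookup i))
lookup-injective (_ ∷ u)  (suc i) (suc j) eq = cong suc (lookup-injective u i j eq)

Unique⇒length≤ : {xs : List (Fin n)} → Unique xs → length xs ≤ n
Unique⇒length≤ u = Finₚ.injective⇒≤ λ {i} {j} → lookup-injective u i j

-- Pigeonhole: a missing vertex could be put in front, giving n + 1 distinct elements of `Fin n`.
Unique⇒full : {xs : List (Fin n)} → Unique xs → length xs ≡ n → ∀ v → v ∈ₗ xs
Unique⇒full {n} {xs} u len v with DecMem._∈?_ Fin._≟_ v xs
... | yes v∈ = v∈
... | no  v∉ = contradiction
  (subst (λ l → suc l ≤ n) len (Unique⇒length≤ (Allₚ.¬Any⇒All¬ xs v∉ ∷ u))) ℕₚ.1+n≰n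

least : {P : ℕ → Set} → Decidable P → ∀ b → P b → ∃ λ m → P m × (∀ j → j < m → ¬ P j)
least P? zero    Pb = zero , Pb , λ _ ()
least P? (suc b) Pb with P? 0
... | yes P0 = 0 , P0 , λ _ ()
... | no ¬P0 with least (P? ∘ suc) b Pb
...   | m , Pm , below = suc m , Pm , λ { zero _ → ¬P0 ; (suc j) (s≤s j<m) → below j j<m }

-- Deciding whether a packing exists

listsUpTo : ℕ → List (List (Fin n))
listsUpTo zero    = [] ∷ []
listsUpTo (suc l) = [] ∷ cartesianProductWith _∷_ (allFin _) (listsUpTo l)

∈-listsUpTo : ∀ l (xs : List (Fin n)) → length xs ≤ l → xs ∈ₗ listsUpTo l
∈-listsUpTo zero    []       _        = here refl
∈-listsUpTo (suc l) []       _        = here refl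
∈-listsUpTo (suc l) (x ∷ xs) (s≤s le) =
  there (∈ₚ.∈-cartesianProductWith⁺ _∷_ (∈ₚ.∈-allFin x) (∈-listsUpTo l xs le))

isSRPath? : (D : Digraph n) (S : Subset n) (r : Fin n) → Decidable (IsSRPath D S r)
isSRPath? D S r rest =
  (DecUnique.unique? Fin._≟_ (r ∷ rest) ×-dec Linked.linked? (λ u v → T? (arc D u v)) (r ∷ rest))
  ×-dec Finₚ.all? (λ v → (v Subₚ.∈? S) →-dec DecMem._∈?_ Fin._≟_ v (r ∷ rest))

arcDisjoint? : (P Q : List (Fin n)) → Dec (ArcDisjoint P Q)
arcDisjoint? P Q = map′ (λ d a → All.lookup d) (λ d → All.tabulate (d _))
  (All.all? (λ a → ¬? (DecMem._∈?_ (×ₚ.≡-dec Fin._≟_ Fin._≟_) a (arcs Q))) (arcs P))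

-- A path has at most n vertices, so its list is one of finitely many candidates, and a choice of m
-- of them is coded by a number. This makes the search over families of paths finite.
srPacking? : (D : Digraph n) (S : Subset n) (r : Fin n) → Decidable (SRPacking D S r)
srPacking? {n} D S r m = map′ to from
  (Finₚ.any? λ code →
    Finₚ.all? (λ i → isSRPath? D S r (path code i)) ×-dec
    Finₚ.all? (λ i → Finₚ.all? λ j →
      ¬? (i Finₚ.≟ j) →-dec arcDisjoint? (r ∷ path code i) (r ∷ path code j)))
  where
  candidates : List (List (Fin n))
  candidates = listsUpTo n
  path : Fin (length candidates ^ m) → Fin m → List (Fin n)
  path code i = lookup candidates (finToFun code i)
  Good : (Fin m → List (Fin n)) → Set
  Good Ps = (∀ i → IsSRPath D S r (Ps i)) ×
            (∀ i j → i ≢ j → ArcDisjoint (r ∷ Ps i) (r ∷ Ps j))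
  to : ∃ (λ code → Good (path code)) → SRPacking D S r m
  to (code , good) = path code , good
  from : SRPacking D S r m → ∃ λ code → Good (path code)
  from (Ps , isP , disj) = funToFin index ,
    -- The decoded family equals `Ps` only pointwise, so each property is transported index by
    -- index.
    (λ i → subst (IsSRPath D S r) (sym (path≡ i)) (isP i)) ,
    (λ i j i≢j → subst₂ (λ P Q → ArcDisjoint (r ∷ P) (r ∷ Q)) (sym (path≡ i)) (sym (path≡ j)) (disj i j i≢j))
    where
    Ps∈ : ∀ i → Ps i ∈ₗ candidates
    Ps∈ i = ∈-listsUpTo n (Ps i) (ℕₚ.≤-trans (ℕₚ.n≤1+n _) (Unique⇒length≤ (proj₁ (proj₁ (isP i)))))
    index : Fin m → Fin (length candidates)
    index i = Any.index (Ps∈ i)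
    path≡ : ∀ i → path (funToFin index) i ≡ Ps i
    path≡ i = trans (cong (lookup candidates) (Finₚ.finToFun-funToFin index i))
                    (sym (Anyₚ.lookup-index (Ps∈ i)))

-- Makes packability downward closed, so failure at `suc m` rules out every larger packing.
restrict : ∀ (D : Digraph n) {S r m m′} → m ≤ m′ → SRPacking D S r m′ → SRPacking D S r m
restrict D m≤m′ (Ps , isP , disj) =
  (λ i → Ps (inject≤ i m≤m′)) , (λ i → isP _) ,
  (λ i j i≢j → disj _ _ (i≢j ∘ Finₚ.inject≤-injective m≤m′ m≤m′ i j))

-- Subsets, first arcs and the upper bound

subsetOfSize : ∀ n k → k ≤ n → ∃ λ (S : Subset n) → ∣ S ∣ ≡ k
subsetOfSize zero    zero    _         = [] , refl
subsetOfSize (suc n) zero    _         with subsetOfSize n 0 z≤n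
... | S , eq = outside ∷ S , eq
subsetOfSize (suc n) (suc k) (s≤s k≤n) with subsetOfSize n k k≤n
... | S , eq = inside ∷ S , cong suc eq

subsetOfSize∋ : ∀ {n} (r : Fin n) k → 1 ≤ k → k ≤ n → ∃ λ (S : Subset n) → ∣ S ∣ ≡ k × r ∈ S
subsetOfSize∋ {suc n} zero    (suc k) _   (s≤s k≤n) with subsetOfSize n k k≤n
... | S , eq = inside ∷ S , cong suc eq , here
subsetOfSize∋ {suc n} (suc r) k       1≤k k≤n with ℕₚ.m≤n⇒m<n∨m≡n k≤n
-- Vertex `zero` can be left out unless k is the full order, and then the whole vertex set serves.
... | inj₂ refl = ⊤ , Subₚ.∣⊤∣≡n (suc n) , Subₚ.∈⊤
... | inj₁ (s≤s k≤n′) with subsetOfSize∋ r k 1≤k k≤n′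
...   | S , eq , r∈S = outside ∷ S , eq , there r∈S

another : ∀ {n} {S : Subset n} {r} → 2 ≤ ∣ S ∣ → r ∈ S → ∃ λ v → v ∈ S × v ≢ r
another {S = S} {r} 2≤ r∈S with Finₚ.any? (λ v → (v Subₚ.∈? S) ×-dec ¬? (v Finₚ.≟ r))
... | yes found = found
... | no  none  = contradiction
  (ℕₚ.≤-trans 2≤ (subst (∣ S ∣ ≤_) (Subₚ.∣⁅x⁆∣≡1 r) (Subₚ.p⊆q⇒∣p∣≤∣q∣ S⊆)))
  λ { (s≤s ()) }
  where
  S⊆ : ∀ {v} → v ∈ S → v ∈ ⁅ r ⁆
  S⊆ {v} v∈S with v Finₚ.≟ r
  ... | yes refl = Subₚ.x∈⁅x⁆ r
  ... | no  v≢r  = contradiction (v , v∈S , v≢r) none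

-- Here `2 ≤ ∣ S ∣` enters: the trivial path at `r` misses a second element of `S`.
firstArc : ∀ (D : Digraph n) {S r rest} → 2 ≤ ∣ S ∣ → r ∈ S → IsSRPath D S r rest →
  ∃ λ v → T (arc D r v) × (r , v) ∈ₗ arcs (r ∷ rest)
firstArc D {S} {rest = []} 2≤ r∈S (_ , S⊆) with another {S = S} 2≤ r∈S
... | v , v∈S , v≢r with S⊆ v v∈S
...   | here v≡r = contradiction v≡r v≢r
firstArc D {rest = v ∷ rest} _ _ ((_ , (rv ∷ _)) , _) = v , rv , here refl

-- Disjoint paths have different first arcs, and since these share the tail `r`, their heads differ.
firstVertices : ∀ (D : Digraph n) {S r m} → 2 ≤ ∣ S ∣ → r ∈ S → SRPacking D S r m →
  ∃ λ vs → Unique vs × length vs ≡ m × All (λ v → T (arc D r v)) vs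
firstVertices D {S} {r} {m} 2≤ r∈S (Ps , isP , disj) =
  tabulate first , Uniqueₚ.tabulate⁺ inj , Listₚ.length-tabulate first ,
  Allₚ.tabulate⁺ (λ i → proj₁ (proj₂ (arc₁ i)))
  where
  arc₁ : ∀ i → ∃ λ v → T (arc D r v) × (r , v) ∈ₗ arcs (r ∷ Ps i)
  arc₁ i = firstArc D 2≤ r∈S (isP i)
  first : Fin m → Fin _
  first i = proj₁ (arc₁ i)
  inj : ∀ {i j} → first i ≡ first j → i ≡ j
  inj {i} {j} eq with i Finₚ.≟ j
  ... | yes i≡j = i≡j
  ... | no  i≢j = contradiction
    (subst (λ v → (r , v) ∈ₗ arcs (r ∷ Ps j)) (sym eq) (proj₂ (proj₂ (arc₁ j))))
    (disj i j i≢j _ (proj₂ (proj₂ (arc₁ i))))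

arc⇒≢ : (D : Digraph n) → ∀ {u v} → T (arc D u v) → u ≢ v
arc⇒≢ D {u} uv refl = subst T (loopless D u) uv

arcᶜ⇒¬arc : (D : Digraph n) → ∀ {u v} → T (arc (D ᶜ) u v) → ¬ T (arc D u v)
arcᶜ⇒¬arc D {u} {v} uvᶜ uv with u Fin.≟ v
arcᶜ⇒¬arc D {u} {v} () uv | yes _
... | no _ with arc D u v
...   | true = uvᶜ

-- The root, the first vertices in `D` and those in `D ᶜ` are 1 + a + b distinct vertices.
packings-bound : ∀ (D : Digraph n) {S r a b} → 2 ≤ ∣ S ∣ → r ∈ S →
  SRPacking D S r a → SRPacking (D ᶜ) S r b → a + b < n
packings-bound {n} D {S} {r} 2≤ r∈S p q
  with firstVertices D 2≤ r∈S p | firstVertices (D ᶜ) 2≤ r∈S q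
... | us , us! , refl , rus | vs , vs! , refl , rvs =
  subst (λ l → suc l ≤ n) (Listₚ.length-++ us)
    (Unique⇒length≤ (Allₚ.++⁺ (All.map (arc⇒≢ D) rus) (All.map (arc⇒≢ (D ᶜ)) rvs)
                     ∷ Uniqueₚ.++⁺ us! vs! λ (∈us , ∈vs) →
                         arcᶜ⇒¬arc D (All.lookup rvs ∈vs) (All.lookup rus ∈us)))

no-large-packing : ∀ (D : Digraph n) {S r m} → 2 ≤ ∣ S ∣ → r ∈ S → SRPacking D S r m → m < n
no-large-packing D {m = m} 2≤ r∈S p =
  -- The empty packing serves in `D ᶜ`, so the second summand is 0.
  subst (_< _) (ℕₚ.+-identityʳ m) (packings-bound D 2≤ r∈S p ((λ ()) , (λ ()) , λ ()))

-- IsMinPacking D k m pins down m = λᵖₖ(D) without mentioning the individual λᵖ_{S,r}(D).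
IsMinPacking : Digraph n → ℕ → ℕ → Set
IsMinPacking {n} D k m =
  (∀ (S : Subset n) r → ∣ S ∣ ≡ k → r ∈ S → SRPacking D S r m) ×
  (Σ (Subset n) λ S → Σ (Fin n) λ r → ∣ S ∣ ≡ k × r ∈ S × ¬ SRPacking D S r (suc m))

isMinPacking-bounds : ∀ (D : Digraph n) {k m l} → IsMinPacking D k m →
  (∀ (S : Subset n) r → ∣ S ∣ ≡ k → r ∈ S → SRPacking D S r l) → l ≤ m
isMinPacking-bounds D (_ , S , r , ∣S∣ , r∈S , ¬p) all =
  ℕₚ.≮⇒≥ λ m<l → ¬p (restrict D m<l (all S r ∣S∣ r∈S))

-- At the pair where `suc m` paths fail, m paths still exist, so the maximum there is exactly m; at
-- every other pair it is at least m.
isMinPacking⇒isLambdaK : ∀ (D : Digraph n) {k m} → IsMinPacking D k m → IsLambdaK D k m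
isMinPacking⇒isLambdaK D {m = m} (all , S , r , ∣S∣ , r∈S , ¬p) =
  (S , r , ∣S∣ , r∈S , all S r ∣S∣ r∈S , λ m′ p → ℕₚ.≮⇒≥ λ m<m′ → ¬p (restrict D m<m′ p)) ,
  λ S r ∣S∣ r∈S m′ (_ , max) → max m (all S r ∣S∣ r∈S)

isLambdaK-≤ : ∀ (D : Digraph n) {k m l} → IsMinPacking D k m → IsLambdaK D k l → l ≤ m
isLambdaK-≤ D {m = m} (all , S , r , ∣S∣ , r∈S , ¬p) (_ , min) =
  min S r ∣S∣ r∈S m (all S r ∣S∣ r∈S , λ m′ p → ℕₚ.≮⇒≥ λ m<m′ → ¬p (restrict D m<m′ p))

module _ {n k : ℕ} (2≤k : 2 ≤ k) (k≤n : k ≤ n) where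

  private
    2≤size : ∀ (S : Subset n) → ∣ S ∣ ≡ k → 2 ≤ ∣ S ∣
    2≤size S eq = subst (2 ≤_) (sym eq) 2≤k

  -- The value is the least m such that `suc m` paths fail at some pair. Below it no pair fails, and
  -- decidability turns this into actual packings.
  isMinPacking : (D : Digraph n) → ∃ (IsMinPacking D k)
  isMinPacking D with least fails? n (fails-n (ℕₚ.≤-trans 2≤k k≤n))
    where
    Fails : ℕ → Set
    Fails m = Σ (Subset n) λ S → Σ (Fin n) λ r → ∣ S ∣ ≡ k × r ∈ S × ¬ SRPacking D S r (suc m)
    fails? : Decidable Fails
    fails? m = Subₚ.anySubset? λ S → Finₚ.any? λ r →
      (∣ S ∣ ℕ.≟ k) ×-dec ((r Subₚ.∈? S) ×-dec ¬? (srPacking? D S r (suc m)))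
    fails-n : 2 ≤ n → Fails n
    fails-n (s≤s _) with subsetOfSize∋ {n} zero k (ℕₚ.<⇒≤ 2≤k) k≤n
    ... | S , eq , r∈S = S , zero , eq , r∈S , λ p → ℕₚ.<-asym ℕₚ.≤-refl (no-large-packing D (2≤size S eq) r∈S p)
  ... | zero  , fails , _     = zero , (λ S r _ _ → (λ ()) , (λ ()) , λ ()) , fails
  ... | suc m , fails , below = suc m , (λ S r ∣S∣ r∈S → decidable-stable (srPacking? D S r (suc m))
                                   λ ¬p → below m ℕₚ.≤-refl (S , r , ∣S∣ , r∈S , ¬p)) , fails

  isMinPacking-sum : ∀ (D : Digraph n) {a b} → IsMinPacking D k a → IsMinPacking (D ᶜ) k b → a + b < n
  isMinPacking-sum D (p , S , r , ∣S∣ , r∈S , _) (q , _) =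
    packings-bound D (2≤size S ∣S∣) r∈S (p S r ∣S∣ r∈S) (q S r ∣S∣ r∈S)

-- Hamiltonian decompositions

Unique-resp-↭ : {xs ys : List X} → xs ↭ ys → Unique xs → Unique ys
Unique-resp-↭ p = ↭ₛₚ.Unique-resp-↭ (setoid _) (↭⇒↭ₛ p)

-- The joint `m` is kept in both pieces, so no link is lost at the cut.
Linked-++⁻ : ∀ xs {m : X} {ys} → Linked R (xs ++ m ∷ ys) → Linked R (xs ++ [ m ]) × Linked R (m ∷ ys)
Linked-++⁻ []           l       = [-] , l
Linked-++⁻ (x ∷ [])     (r ∷ l) = r ∷ [-] , l
Linked-++⁻ (x ∷ y ∷ xs) (r ∷ l) with Linked-++⁻ (y ∷ xs) l
... | l₁ , l₂ = r ∷ l₁ , l₂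

Linked-++⁺ : ∀ xs {m : X} {ys} → Linked R (xs ++ [ m ]) → Linked R (m ∷ ys) → Linked R (xs ++ m ∷ ys)
Linked-++⁺ []           _       l = l
Linked-++⁺ (x ∷ [])     (r ∷ _) l = r ∷ l
Linked-++⁺ (x ∷ y ∷ xs) (r ∷ k) l = r ∷ Linked-++⁺ (y ∷ xs) k l

Linked-init : ∀ xs {m : X} → Linked R (xs ++ [ m ]) → Linked R xs
Linked-init []           _       = []
Linked-init (x ∷ [])     _       = [-]
Linked-init (x ∷ y ∷ xs) (r ∷ l) = r ∷ Linked-init (y ∷ xs) l

toFins : {xs : List ℕ} → All (_< n) xs → ∃ λ ys → map (toℕ {n}) ys ≡ xs
toFins []         = [] , refl
toFins (x< ∷ xs<) with toFins xs<
... | ys , eq = fromℕ< x< ∷ ys , cong₂ _∷_ (Finₚ.toℕ-fromℕ< x<) eq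

Unique⇒full-ℕ : {xs : List ℕ} → Unique xs → All (_< n) xs → length xs ≡ n → ∀ {v} → v < n → v ∈ₗ xs
Unique⇒full-ℕ xs! xs< len v< with toFins xs<
... | ys , refl = subst (_∈ₗ map toℕ ys) (Finₚ.toℕ-fromℕ< v<)
  (∈ₚ.∈-map⁺ toℕ (Unique⇒full (Uniqueₚ.map⁻ xs!) (trans (sym (Listₚ.length-map toℕ ys)) len) (fromℕ< v<)))

-- Vertices are natural numbers, which lets the cycles be given by arithmetic. The start is repeated
-- only in `closed`, to supply the closing arc.
record HamCycle (R : ℕ → ℕ → Set) (n r : ℕ) (rest : List ℕ) : Set where
  constructor hamCycle
  field
    unique : Unique (r ∷ rest)
    below  : All (_< n) (r ∷ rest)
    size   : length (r ∷ rest) ≡ n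
    closed : Linked R (r ∷ rest ++ [ r ])

-- Cutting the closed walk at `v` and exchanging the two pieces keeps every arc.
rotate : ∀ {R r rest v} → HamCycle R n r rest → v < n → ∃ (HamCycle R n v)
rotate {r = r} {rest} {v} h@(hamCycle u b s c) v<n
  with ∈ₚ.∈-∃++ (Unique⇒full-ℕ u b s v<n)
... | []     , zs , refl = zs , h
... | x ∷ ys , zs , refl = zs ++ x ∷ ys ,
  hamCycle (Unique-resp-↭ perm u) (↭ₚ.All-resp-↭ perm b) (trans (sym (↭ₚ.↭-length perm)) s)
    (subst (Linked _) (sym (Listₚ.++-assoc (v ∷ zs) (x ∷ ys) [ v ]))
      (Linked-++⁺ (v ∷ zs) (proj₂ parts) (proj₁ parts)))
  where
  perm : x ∷ ys ++ v ∷ zs ↭ v ∷ zs ++ x ∷ ys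
  perm = ↭ₚ.++-comm (x ∷ ys) (v ∷ zs)
  parts = Linked-++⁻ (x ∷ ys) (subst (Linked _) (Listₚ.++-assoc (x ∷ ys) (v ∷ zs) [ x ]) c)

-- A Hamiltonian decomposition of the complete digraph on N + 1 vertices, given as an arc
-- colouring whose N colour classes each contain a Hamiltonian cycle.
HamColouring : ℕ → (ℕ → ℕ → ℕ) → Set
HamColouring N col = ∀ (i : Fin N) → ∃₂ (HamCycle (λ u v → col u v ≡ toℕ i) (suc N))

-- The cycle is rotated to start at `r` and its closing arc is dropped.
hamPath : ∀ {N col} → HamColouring N col → ∀ (i : Fin N) (r : Fin (suc N)) →
  ∃ λ rest → Unique (r ∷ rest) × length (r ∷ rest) ≡ suc N ×
    Linked (λ u v → col (toℕ u) (toℕ v) ≡ toℕ i) (r ∷ rest)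
hamPath ham i r with ham i
... | _ , _ , h with rotate h (Finₚ.toℕ<n r)
...   | rest , hamCycle u (_ ∷ b) s c with toFins b
...     | rest′ , refl = rest′ , Uniqueₚ.map⁻ u , trans (cong suc (sym (Listₚ.length-map toℕ rest′))) s ,
                         Linkedₚ.map⁻ (Linked-init (toℕ r ∷ rest) c)

-- Packings from colour classes

Linked⇒arcs : {R : Fin n → Fin n → Set} → ∀ P → Linked R P → ∀ {u v} → (u , v) ∈ₗ arcs P → R u v
Linked⇒arcs (_ ∷ _ ∷ _) (r ∷ _) (here refl) = r
Linked⇒arcs (_ ∷ _ ∷ _) (_ ∷ l) (there a∈)  = Linked⇒arcs _ l a∈

-- A Hamiltonian path covers any `S`, and an arc shared by two of the paths would have two colours.
colourPacking : ∀ {N col} → HamColouring N col → ∀ (D : Digraph (suc N)) {m} (colour : Fin m → Fin N) →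
  (∀ {i j} → colour i ≡ colour j → i ≡ j) →
  (∀ i {u v} → u ≢ v → col (toℕ u) (toℕ v) ≡ toℕ (colour i) → T (arc D u v)) →
  ∀ S r → SRPacking D S r m
colourPacking {N} {col} ham D {m} colour inj coloured S r =
  (λ i → proj₁ (path i)) , isP , disj
  where
  path : ∀ i → ∃ _
  path i = hamPath ham (colour i) r
  isP : ∀ i → IsSRPath D S r (proj₁ (path i))
  isP i with path i
  ... | rest , u , s , l =
    (u , Linked.zipWith (λ (u≢v , c) → coloured i u≢v c) (Linkedₚ.AllPairs⇒Linked u , l)) ,
    λ v _ → Unique⇒full u s v
  disj : ∀ i j → i ≢ j → ArcDisjoint (r ∷ proj₁ (path i)) (r ∷ proj₁ (path j))
  disj i j i≢j (u , v) ∈i ∈j = i≢j (inj (Finₚ.toℕ-injective (trans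
    (sym (Linked⇒arcs (r ∷ _) (proj₂ (proj₂ (proj₂ (path i)))) ∈i))
    (Linked⇒arcs (r ∷ _) (proj₂ (proj₂ (proj₂ (path j)))) ∈j))))

-- The union of the colour classes below `a`. Loops are removed explicitly because `col` also takes
-- values on the diagonal.
lowColours : ∀ n → (ℕ → ℕ → ℕ) → ℕ → Digraph n
arc      (lowColours n col a) u v = not (does (u Fin.≟ v)) ∧ (col (toℕ u) (toℕ v) <ᵇ a)
loopless (lowColours n col a) v rewrite dec-true (v Fin.≟ v) refl = refl

module _ {N k : ℕ} (2≤k : 2 ≤ k) (k≤n : k ≤ suc N) {col : ℕ → ℕ → ℕ} (ham : HamColouring N col) where

  -- The colour classes bound the two values from below by a and b, and the upper bound on their sum
  -- leaves no room above.
  decomposition⇒sharp : ∀ a b → a + b ≡ N → Σ (Digraph (suc N)) λ D → IsLambdaK D k a × IsLambdaK (D ᶜ) k b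
  decomposition⇒sharp a b refl with isMinPacking 2≤k k≤n D | isMinPacking 2≤k k≤n (D ᶜ)
    where D = lowColours (suc (a + b)) col a
  ... | a* , mina | b* , minb = D ,
    subst (IsLambdaK D k) (ℕₚ.≤-antisym a*≤a a≤a*) (isMinPacking⇒isLambdaK D mina) ,
    subst (IsLambdaK (D ᶜ) k) (ℕₚ.≤-antisym b*≤b b≤b*) (isMinPacking⇒isLambdaK (D ᶜ) minb)
    where
    D = lowColours (suc (a + b)) col a
    low : ∀ (i : Fin a) {u v} → u ≢ v → col (toℕ u) (toℕ v) ≡ toℕ (i Fin.↑ˡ b) → T (arc D u v)
    low i {u} {v} u≢v eq rewrite dec-false (u Fin.≟ v) u≢v | eq | Finₚ.toℕ-↑ˡ i b = ℕₚ.<⇒<ᵇ (Finₚ.toℕ<n i)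
    high : ∀ (i : Fin b) {u v} → u ≢ v → col (toℕ u) (toℕ v) ≡ toℕ (a Fin.↑ʳ i) → T (arc (D ᶜ) u v)
    high i {u} {v} u≢v eq rewrite dec-false (u Fin.≟ v) u≢v | eq | Finₚ.toℕ-↑ʳ a i
      with a + toℕ i <ᵇ a in lt
    ... | false = _
    ... | true  = contradiction (ℕₚ.<ᵇ⇒< (a + toℕ i) a (subst T (sym lt) _)) (ℕₚ.m+n≮m a (toℕ i))
    a≤a* : a ≤ a*
    a≤a* = isMinPacking-bounds D mina λ S r _ _ →
      colourPacking ham D (Fin._↑ˡ b) (Finₚ.↑ˡ-injective b _ _) low S r
    b≤b* : b ≤ b*
    b≤b* = isMinPacking-bounds (D ᶜ) minb λ S r _ _ →
      colourPacking ham (D ᶜ) (a Fin.↑ʳ_) (Finₚ.↑ʳ-injective a _ _) high S r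
    sum : a* + b* ≤ a + b
    sum = ℕₚ.≤-pred (isMinPacking-sum 2≤k k≤n D mina minb)
    a*≤a : a* ≤ a
    a*≤a = ℕₚ.+-cancelʳ-≤ b a* a (ℕₚ.≤-trans (ℕₚ.+-monoʳ-≤ a* b≤b*) sum)
    b*≤b : b* ≤ b
    b*≤b = ℕₚ.+-cancelˡ-≤ a b* b (ℕₚ.≤-trans (ℕₚ.+-monoˡ-≤ b* a≤a*) sum)

-- Inserting a vertex along a rainbow path

pairs : List X → List (X × X)
pairs []           = []
pairs (_ ∷ [])     = []
pairs (x ∷ y ∷ xs) = (x , y) ∷ pairs (y ∷ xs)

pairs-linked : (xs : List X) → Linked (λ x y → (x , y) ∈ₗ pairs xs) xs
pairs-linked []           = []
pairs-linked (_ ∷ [])     = [-]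
pairs-linked (x ∷ y ∷ xs) = here refl ∷ Linked.map there (pairs-linked (y ∷ xs))

Linked⇒pairs : {R : X → X → Set} → ∀ xs → Linked R xs → ∀ {x y} → (x , y) ∈ₗ pairs xs → R x y
Linked⇒pairs (_ ∷ _ ∷ _) (r ∷ _) (here refl) = r
Linked⇒pairs (_ ∷ _ ∷ _) (_ ∷ l) (there p∈)  = Linked⇒pairs _ l p∈

proj₁-pairs : ∀ (xs : List X) z → map proj₁ (pairs (xs ++ [ z ])) ≡ xs
proj₁-pairs []           z = refl
proj₁-pairs (x ∷ [])     z = refl
proj₁-pairs (x ∷ y ∷ xs) z = cong (x ∷_) (proj₁-pairs (y ∷ xs) z)

proj₂-pairs : ∀ (x : X) xs → map proj₂ (pairs (x ∷ xs)) ≡ xs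
proj₂-pairs x []       = refl
proj₂-pairs x (y ∷ xs) = cong (y ∷_) (proj₂-pairs y xs)

Unique-map-injective : ∀ {f : X → Y} {xs} → Unique (map f xs) → ∀ {x y} → x ∈ₗ xs → y ∈ₗ xs → f x ≡ f y → x ≡ y
Unique-map-injective _        (here refl) (here refl) _  = refl
Unique-map-injective (x∉ ∷ _) (here refl) (there y∈)  eq = contradiction eq (All.lookup x∉ (∈ₚ.∈-map⁺ _ y∈))
Unique-map-injective (x∉ ∷ _) (there x∈)  (here refl) eq = contradiction (sym eq) (All.lookup x∉ (∈ₚ.∈-map⁺ _ x∈))
Unique-map-injective (_ ∷ u)  (there x∈)  (there y∈)  eq = Unique-map-injective u x∈ y∈ eq

module _ (key : X → ℕ) (val : X → Y) (default : Y) where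

  search : List X → ℕ → Y
  search []       k = default
  search (x ∷ xs) k = if does (key x ℕ.≟ k) then val x else search xs k

  search-∈ : ∀ {xs x} → Unique (map key xs) → x ∈ₗ xs → search xs (key x) ≡ val x
  search-∈ {x ∷ xs} _ (here refl) rewrite dec-true (key x ℕ.≟ key x) refl = refl
  search-∈ {y ∷ xs} {x} (y∉ ∷ u) (there x∈)
    rewrite dec-false (key y ℕ.≟ key x) (All.lookup y∉ (∈ₚ.∈-map⁺ key x∈)) = search-∈ u x∈

  search-∉ : ∀ {xs k} → k ∉ₗ map key xs → search xs k ≡ default
  search-∉ {[]}         _  = refl
  search-∉ {x ∷ xs} {k} k∉ rewrite dec-false (key x ℕ.≟ k) (k∉ ∘ here ∘ sym) = search-∉ {xs} (k∉ ∘ there)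

module Insertion {N : ℕ} {col : ℕ → ℕ → ℕ} (ham : HamColouring N col) (first last : ℕ) (mid : List ℕ)
  (path! : Unique (first ∷ mid ++ [ last ]))
  (path< : All (_< suc N) (first ∷ mid ++ [ last ]))
  (size : length (first ∷ mid ++ [ last ]) ≡ suc N)
  (colours! : Unique (map (uncurry col) (pairs (first ∷ mid ++ [ last ]))))
  (colours< : All (_< N) (map (uncurry col) (pairs (first ∷ mid ++ [ last ]))))
  where

  private
    path : List ℕ
    path = first ∷ mid ++ [ last ]

    w : ℕ
    w = suc N

    arcs! : ∀ {a b} → a ∈ₗ pairs path → b ∈ₗ pairs path → uncurry col a ≡ uncurry col b → a ≡ b
    arcs! = Unique-map-injective colours!

    _∈path? : ∀ a → Dec (a ∈ₗ pairs path)
    a ∈path? = DecMem._∈?_ (×ₚ.≡-dec ℕ._≟_ ℕ._≟_) a (pairs path)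

    path!′ : Unique (last ∷ first ∷ mid)
    path!′ = Unique-resp-↭ (↭ₚ.++-comm (first ∷ mid) [ last ]) path!

    init! : Unique (map proj₁ (pairs path))
    init! = subst Unique (sym (proj₁-pairs (first ∷ mid) last)) (AllPairs.tail path!′)

    tail! : Unique (map proj₂ (pairs path))
    tail! = subst Unique (sym (proj₂-pairs first (mid ++ [ last ]))) (AllPairs.tail path!)

    last∉ : last ∉ₗ map proj₁ (pairs path)
    last∉ = subst (last ∉ₗ_) (sym (proj₁-pairs (first ∷ mid) last)) (Uniqueₚ.Unique[x∷xs]⇒x∉xs path!′)

    first∉ : first ∉ₗ map proj₂ (pairs path)
    first∉ = subst (first ∉ₗ_) (sym (proj₂-pairs first (mid ++ [ last ]))) (Uniqueₚ.Unique[x∷xs]⇒x∉xs path!)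

  -- A path arc p → q of colour c is recoloured N, and c passes to p → `w` and `w` → q. The default
  -- N falls on `w` → `first` and `last` → `w`, which close the path in the new colour.
  col⁺ : ℕ → ℕ → ℕ
  col⁺ u v =
    if does (u ℕ.≟ w) then search proj₂ (uncurry col) N (pairs path) v else
    if does (v ℕ.≟ w) then search proj₁ (uncurry col) N (pairs path) u else
    if does ((u , v) ∈path?) then N else col u v

  col⁺-from : ∀ v → col⁺ w v ≡ search proj₂ (uncurry col) N (pairs path) v
  col⁺-from v rewrite dec-true (w ℕ.≟ w) refl = refl

  col⁺-to : ∀ {u} → u < w → col⁺ u w ≡ search proj₁ (uncurry col) N (pairs path) u
  col⁺-to {u} u<w rewrite dec-false (u ℕ.≟ w) (ℕₚ.<⇒≢ u<w) | dec-true (w ℕ.≟ w) refl = refl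

  col⁺-on : ∀ {u v} → u < w → v < w → (u , v) ∈ₗ pairs path → col⁺ u v ≡ N
  col⁺-on {u} {v} u<w v<w uv∈ rewrite dec-false (u ℕ.≟ w) (ℕₚ.<⇒≢ u<w)
    | dec-false (v ℕ.≟ w) (ℕₚ.<⇒≢ v<w) | dec-true ((u , v) ∈path?) uv∈ = refl

  col⁺-off : ∀ {u v} → u < w → v < w → (u , v) ∉ₗ pairs path → col⁺ u v ≡ col u v
  col⁺-off {u} {v} u<w v<w uv∉ rewrite dec-false (u ℕ.≟ w) (ℕₚ.<⇒≢ u<w)
    | dec-false (v ℕ.≟ w) (ℕₚ.<⇒≢ v<w) | dec-false ((u , v) ∈path?) uv∉ = refl

  private
    pathCycle : HamCycle (λ u v → col⁺ u v ≡ N) (suc w) w path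
    pathCycle = hamCycle (All.map (λ v<w w≡v → ℕₚ.<⇒≢ v<w (sym w≡v)) path< ∷ path!)
      (ℕₚ.≤-refl ∷ All.map ℕₚ.m<n⇒m<1+n path<) (cong suc size)
      (trans (col⁺-from first) (search-∉ proj₂ _ N first∉) ∷
       subst (Linked _) (sym (Listₚ.++-assoc (first ∷ mid) [ last ] [ w ]))
         (Linked-++⁺ (first ∷ mid) (on path< (pairs-linked path))
           (trans (col⁺-to (All.head (Allₚ.++⁻ʳ (first ∷ mid) path<))) (search-∉ proj₁ _ N last∉) ∷ [-])))
      where
      on : ∀ {xs} → All (_< w) xs → Linked (λ u v → (u , v) ∈ₗ pairs path) xs → Linked (λ u v → col⁺ u v ≡ N) xs
      on _              []      = []
      on _              [-]     = [-]
      on (x< ∷ y< ∷ b)  (r ∷ l) = col⁺-on x< y< r ∷ on (y< ∷ b) l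

    cycleFrom : ∀ {p} → p < w → (i : Fin N) → ∃₂ λ q rest → HamCycle (λ u v → col u v ≡ toℕ i) w p (q ∷ rest)
    cycleFrom p<w i with rotate (proj₂ (proj₂ (ham i))) p<w
    ... | q ∷ rest , h = q , rest , h
    -- A cycle with a single vertex would make N zero, but `i` is a colour below N.
    ... | []       , h = contradiction (subst Fin (sym (ℕₚ.suc-injective (HamCycle.size h))) i) Finₚ.¬Fin0

    -- The N successors of p in the N cycles are distinct, hence exhaust the other vertices.
    successor : ∀ {p q} (p<w : p < w) → q < w → p ≢ q → ∀ i → col p q ≡ toℕ i → q ≡ proj₁ (cycleFrom p<w i)
    successor {p} {q} p<w q<w p≢q i colour
      with Unique⇒full-ℕ all! all< (cong suc (Listₚ.length-tabulate succ)) q<w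
      where
      succ : Fin N → ℕ
      succ j = proj₁ (cycleFrom p<w j)
      colour-succ : ∀ j → col p (succ j) ≡ toℕ j
      colour-succ j = Linked.head (HamCycle.closed (proj₂ (proj₂ (cycleFrom p<w j))))
      all! : Unique (p ∷ tabulate succ)
      all! = Allₚ.tabulate⁺ (λ j → All.head (AllPairs.head (HamCycle.unique (proj₂ (proj₂ (cycleFrom p<w j)))))) ∷
        Uniqueₚ.tabulate⁺ λ {j} {k} eq → Finₚ.toℕ-injective
          (trans (sym (colour-succ j)) (trans (cong (col p) eq) (colour-succ k)))
      all< : All (_< w) (p ∷ tabulate succ)
      all< = p<w ∷ Allₚ.tabulate⁺ λ j → All.head (All.tail (HamCycle.below (proj₂ (proj₂ (cycleFrom p<w j)))))
    ... | here q≡p = contradiction (sym q≡p) p≢q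
    ... | there q∈ with ∈ₚ.∈-tabulate⁻ q∈
    ...   | j , refl = cong (λ j → proj₁ (cycleFrom p<w j)) (Finₚ.toℕ-injective
              (trans (sym (Linked.head (HamCycle.closed (proj₂ (proj₂ (cycleFrom p<w j)))))) colour))

    -- The N distinct path colours exhaust all colours, so some path arc p → q has colour i. By
    -- `successor` it lies on cycle i, which is opened at this arc and rerouted through `w`.
    insertedCycle : (i : Fin N) → ∃₂ (HamCycle (λ u v → col⁺ u v ≡ toℕ i) (suc w))
    insertedCycle i with ∈ₚ.∈-map⁻ (uncurry col) (Unique⇒full-ℕ colours! colours< ncolours (Finₚ.toℕ<n i))
      where
      ncolours : length (map (uncurry col) (pairs path)) ≡ N
      ncolours = trans (Listₚ.length-map _ (pairs path)) (trans (sym (Listₚ.length-map proj₂ (pairs path)))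
        (trans (cong length (proj₂-pairs first (mid ++ [ last ]))) (ℕₚ.suc-injective size)))
    ... | (p , q) , pq∈ , colour
      with cycleFrom p<w i | successor p<w q<w (Linked⇒pairs path (Linkedₚ.AllPairs⇒Linked path!) pq∈) i (sym colour)
      where
      p<w : p < w
      p<w = All.lookup (Allₚ.++⁻ˡ (first ∷ mid) path<)
        (subst (p ∈ₗ_) (proj₁-pairs (first ∷ mid) last) (∈ₚ.∈-map⁺ proj₁ pq∈))
      q<w : q < w
      q<w = All.lookup (All.tail path<)
        (subst (q ∈ₗ_) (proj₂-pairs first (mid ++ [ last ])) (∈ₚ.∈-map⁺ proj₂ pq∈))
    ...   | _ , rest , hamCycle cycle! cycle< cycleSize (_ ∷ cycle) | refl =
      w , q ∷ rest ++ [ p ] , hamCycle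
        (All.map (λ v<w w≡v → ℕₚ.<⇒≢ v<w (sym w≡v)) new< ∷ new!)
        (ℕₚ.≤-refl ∷ All.map ℕₚ.m<n⇒m<1+n new<)
        (cong suc (trans (sym (↭ₚ.↭-length perm)) cycleSize))
        (trans (col⁺-from q) (trans (search-∈ proj₂ _ N tail! pq∈) (sym colour)) ∷
         subst (Linked _) (sym (Listₚ.++-assoc (q ∷ rest) [ p ] [ w ]))
           (Linked-++⁺ (q ∷ rest) (off new< (All.map (λ q≢v v≡q → q≢v (sym v≡q)) (AllPairs.head new!)) cycle)
             (trans (col⁺-to (All.head cycle<)) (trans (search-∈ proj₁ _ N init! pq∈) (sym colour)) ∷ [-])))
      where
      perm : p ∷ q ∷ rest ↭ q ∷ rest ++ [ p ]
      perm = ↭ₚ.++-comm [ p ] (q ∷ rest)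
      new! : Unique (q ∷ rest ++ [ p ])
      new! = Unique-resp-↭ perm cycle!
      new< : All (_< w) (q ∷ rest ++ [ p ])
      new< = ↭ₚ.All-resp-↭ perm cycle<
      -- Only p → q is both a path arc and of colour i, and no arc considered here ends in `q`, so
      -- all colours are unchanged.
      off : ∀ {x xs} → All (_< w) (x ∷ xs) → All (_≢ q) xs →
        Linked (λ u v → col u v ≡ toℕ i) (x ∷ xs) → Linked (λ u v → col⁺ u v ≡ toℕ i) (x ∷ xs)
      off _             _           [-]     = [-]
      off (x< ∷ y< ∷ b) (y≢q ∷ ≢q) (r ∷ l) = trans (col⁺-off x< y< xy∉) r ∷ off (y< ∷ b) ≢q l
        where xy∉ = λ xy∈ → y≢q (cong proj₂ (arcs! xy∈ pq∈ (trans r colour)))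

  insertion : HamColouring (suc N) col⁺
  insertion i with toℕ i ℕ.<? N
  ... | yes i<N = subst (λ c → ∃₂ (HamCycle (λ u v → col⁺ u v ≡ c) (suc w)))
                    (Finₚ.toℕ-fromℕ< i<N) (insertedCycle (fromℕ< i<N))
  ... | no  i≮N = w , path , subst (λ c → HamCycle (λ u v → col⁺ u v ≡ c) (suc w) w path)
                    (ℕₚ.≤-antisym (ℕₚ.≮⇒≥ i≮N) (ℕₚ.≤-pred (Finₚ.toℕ<n i))) pathCycle

insertVertex : ∀ {N col} → HamColouring N col → ∀ first rest → 0 < length rest →
  Unique (first ∷ rest) → All (_< suc N) (first ∷ rest) → length (first ∷ rest) ≡ suc N →
  Unique (map (uncurry col) (pairs (first ∷ rest))) → All (_< N) (map (uncurry col) (pairs (first ∷ rest))) →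
  ∃ (HamColouring (suc N))
insertVertex ham first rest _ path! path< size colours! colours< with initLast rest
... | mid ∷ʳ′ last = _ , Insertion.insertion ham first last mid path! path< size colours! colours<

-- Walecki's decomposition for odd order

module _ (N : ℕ) .{{_ : NonZero N}} where

  -- Equal remainders of different numbers mean different quotients, and each unit of the quotient
  -- contributes N.
  %-cancel-window : ∀ i {x y} → x < y → (i + x) % N ≡ (i + y) % N → x + N ≤ y
  %-cancel-window i {x} {y} x<y eq = ℕₚ.+-cancelˡ-≤ i (x + N) y (begin
    i + (x + N)              ≡⟨ ℕₚ.+-assoc i x N ⟨
    (i + x) + N              ≡⟨ cong (_+ N) (m≡m%n+[m/n]*n (i + x) N) ⟩
    (r + q * N) + N          ≡⟨ shuffle r q N ⟩
    r + suc q * N            ≤⟨ ℕₚ.+-monoʳ-≤ r (ℕₚ.*-monoˡ-≤ N q<q′) ⟩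
    r + q′ * N               ≡⟨ cong (_+ q′ * N) eq ⟩
    (i + y) % N + q′ * N     ≡⟨ m≡m%n+[m/n]*n (i + y) N ⟨
    i + y                    ∎)
    where
    open ℕₚ.≤-Reasoning
    r = (i + x) % N
    q = (i + x) / N
    q′ = (i + y) / N
    shuffle : ∀ r q N → (r + q * N) + N ≡ r + suc q * N
    shuffle = solve-∀
    q<q′ : q < q′
    q<q′ = ℕₚ.*-cancelʳ-< N q q′ (ℕₚ.+-cancelˡ-< r (q * N) (q′ * N) (begin-strict
      r + q * N              ≡⟨ m≡m%n+[m/n]*n (i + x) N ⟨
      i + x                  <⟨ ℕₚ.+-monoʳ-< i x<y ⟩
      i + y                  ≡⟨ m≡m%n+[m/n]*n (i + y) N ⟩
      (i + y) % N + q′ * N   ≡⟨ cong (_+ q′ * N) eq ⟨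
      r + q′ * N             ∎))

  -- Residues are represented by 1, ..., N because the entries of the zigzag and of the runs below
  -- start at 1.
  Window : ℕ → Set
  Window y = 1 ≤ y × y ≤ N

  %-injective-window : ∀ i {x y} → Window x → Window y → (i + x) % N ≡ (i + y) % N → x ≡ y
  %-injective-window i {x} {y} (1≤x , x≤N) (1≤y , y≤N) eq with ℕₚ.<-cmp x y
  ... | tri≈ _ x≡y _ = x≡y
  ... | tri< x<y _ _ = contradiction (ℕₚ.≤-trans (ℕₚ.+-monoˡ-≤ N 1≤x) (%-cancel-window i x<y eq)) (ℕₚ.<⇒≱ (s≤s y≤N))
  ... | tri> _ _ y<x = contradiction (ℕₚ.≤-trans (ℕₚ.+-monoˡ-≤ N 1≤y) (%-cancel-window i y<x (sym eq))) (ℕₚ.<⇒≱ (s≤s x≤N))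

  Unique-window : ∀ i {xs} → All Window xs → Unique xs → Unique (map (λ y → (i + y) % N) xs)
  Unique-window i []       []       = []
  Unique-window i (x ∷ ws) (x∉ ∷ u) =
    Allₚ.map⁺ (All.zipWith (λ (x≢y , y) eq → x≢y (%-injective-window i x y eq)) (x∉ , ws)) ∷ Unique-window i ws u

module Walecki (t : ℕ) .{{_ : NonZero (t + t)}} where

  private
    N : ℕ
    N = t + t

  -- The number g such that the arc x → x + d (mod 2t) has colour x + g: it is (d ∸ 1) / 2 for odd d
  -- and t + d / 2 for even d.
  offset : ℕ → ℕ
  offset 0             = t
  offset 1             = 0
  offset (suc (suc d)) = suc (offset d)

  -- The vertex N = 2t plays the role of the point at infinity of Walecki's construction.
  col : ℕ → ℕ → ℕ
  col x y =
    if does (x ℕ.≟ N) then y else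
    if does (y ℕ.≟ N) then (x + t) % N else
    (x + offset ((y + (N ∸ x)) % N)) % N

  offset-even : ∀ j → offset (j + j) ≡ j + t
  offset-even zero    = refl
  offset-even (suc j) rewrite ℕₚ.+-suc j j = cong suc (offset-even j)

  offset-odd : ∀ j → offset (suc (j + j)) ≡ j
  offset-odd zero    = refl
  offset-odd (suc j) rewrite ℕₚ.+-suc j j = cong suc (offset-odd j)

  %-+ˡ : ∀ x y → (x % N + y) % N ≡ (x + y) % N
  %-+ˡ x y = begin
    (x % N + y) % N            ≡⟨ %-distribˡ-+ (x % N) y N ⟩
    (x % N % N + y % N) % N    ≡⟨ cong (λ z → (z + y % N) % N) (m%n%n≡m%n x N) ⟩
    (x % N + y % N) % N        ≡⟨ %-distribˡ-+ x y N ⟨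
    (x + y) % N                ∎
    where open ≡-Reasoning

  col-from∞ : ∀ y → col N y ≡ y
  col-from∞ y rewrite dec-true (N ℕ.≟ N) refl = refl

  col-to∞ : ∀ x → col (x % N) N ≡ (x + t) % N
  col-to∞ x rewrite dec-false (x % N ℕ.≟ N) (ℕₚ.<⇒≢ (m%n<n x N)) | dec-true (N ℕ.≟ N) refl = %-+ˡ x t

  -- Since `N ∸ x % N` acts as -x modulo N, `col` recovers the difference d from the two ends.
  col-step : ∀ x d → d < N → col (x % N) ((x + d) % N) ≡ (x + offset d) % N
  col-step x d d<N rewrite dec-false (x % N ℕ.≟ N) (ℕₚ.<⇒≢ (m%n<n x N))
    | dec-false ((x + d) % N ℕ.≟ N) (ℕₚ.<⇒≢ (m%n<n (x + d) N)) =
    trans (cong (λ z → (x % N + offset z) % N) difference) (%-+ˡ x (offset d))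
    where
    open ≡-Reasoning
    difference : ((x + d) % N + (N ∸ x % N)) % N ≡ d
    difference = begin
      ((x + d) % N + (N ∸ x % N)) % N       ≡⟨ cong (λ z → (z + (N ∸ x % N)) % N) (%-+ˡ x d) ⟨
      ((x % N + d) % N + (N ∸ x % N)) % N   ≡⟨ %-+ˡ (x % N + d) _ ⟩
      (x % N + d + (N ∸ x % N)) % N         ≡⟨ cong (_% N) (shuffle (x % N) d (N ∸ x % N)) ⟩
      (d + (x % N + (N ∸ x % N))) % N       ≡⟨ cong (λ z → (d + z) % N) (ℕₚ.m+[n∸m]≡n (ℕₚ.<⇒≤ (m%n<n x N))) ⟩
      (d + N) % N                           ≡⟨ [m+n]%n≡m%n d N ⟩
      d % N                                 ≡⟨ m<n⇒m%n≡m d<N ⟩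
      d                                     ∎
      where
      shuffle : ∀ a b c → a + b + c ≡ b + (a + c)
      shuffle = solve-∀

  -- For f = t and j = 0 this is 2t, 1, 2t - 1, 2, ..., t + 1, t: Walecki's path without ∞, with 2t
  -- standing for 0. The recursion preserves j + f = t.
  zigzag : ℕ → ℕ → List ℕ
  zigzag zero    j = []
  zigzag (suc f) j = t + suc f ∷ suc j ∷ zigzag f (suc j)

  zigzag-length : ∀ f j → length (zigzag f j) ≡ f + f
  zigzag-length zero    j = refl
  zigzag-length (suc f) j = cong suc (trans (cong suc (zigzag-length f (suc j))) (sym (ℕₚ.+-suc f f)))

  zigzag-bounds : ∀ f j → j + f ≡ t → All (λ y → j < y × y ≤ t + f) (zigzag f j)
  zigzag-bounds zero    j eq = []
  zigzag-bounds (suc f) j eq =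
    (ℕₚ.≤-trans (ℕₚ.≤-trans (ℕₚ.m≤m+n (suc j) f) j<t) (ℕₚ.m≤m+n t (suc f)) , ℕₚ.≤-refl) ∷
    (ℕₚ.≤-refl , ℕₚ.≤-trans (ℕₚ.≤-trans (ℕₚ.m≤m+n (suc j) f) j<t) (ℕₚ.m≤m+n t (suc f))) ∷
    All.map (λ (lo , hi) → ℕₚ.<⇒≤ lo , ℕₚ.≤-trans hi (ℕₚ.+-monoʳ-≤ t (ℕₚ.n≤1+n f)))
      (zigzag-bounds f (suc j) (trans (sym (ℕₚ.+-suc j f)) eq))
    where
    j<t : suc j + f ≤ t
    j<t = ℕₚ.≤-reflexive (trans (sym (ℕₚ.+-suc j f)) eq)

  zigzag! : ∀ f j → j + f ≡ t → Unique (zigzag f j)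
  zigzag! zero    j eq = []
  zigzag! (suc f) j eq =
    ((λ e → ℕₚ.<⇒≢ (ℕₚ.≤-<-trans j<t (ℕₚ.m<m+n t z<s)) (sym e)) ∷
      All.map (λ (_ , hi) e → ℕₚ.<⇒≢ (ℕₚ.≤-<-trans hi (ℕₚ.+-monoʳ-< t (ℕₚ.n<1+n f))) (sym e)) bounds) ∷
    All.map (λ (lo , _) → ℕₚ.<⇒≢ lo) bounds ∷ zigzag! f (suc j) eq′
    where
    eq′ : suc j + f ≡ t
    eq′ = trans (sym (ℕₚ.+-suc j f)) eq
    bounds = zigzag-bounds f (suc j) eq′
    j<t : suc j ≤ t
    j<t = ℕₚ.≤-trans (ℕₚ.m≤m+n (suc j) f) (ℕₚ.≤-reflexive eq′)

  module _ (i : ℕ) (i<N : i < N) where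

    private
      vertex : ℕ → ℕ
      vertex y = (i + y) % N

      i+N : (i + N) % N ≡ i
      i+N = trans ([m+n]%n≡m%n i N) (m<n⇒m%n≡m i<N)

    -- Once N is added to the head, the difference is the odd number 2j + 1 with offset j, and tail
    -- plus offset is i + 2t.
    zigzag-up : ∀ f j → j + suc f ≡ t → col (vertex (t + suc f)) (vertex (suc j)) ≡ i
    zigzag-up f j eq = begin
      col (vertex (t + suc f)) (vertex (suc j))                     ≡⟨ cong (col (vertex (t + suc f))) ([m+n]%n≡m%n (i + suc j) N) ⟨
      col (vertex (t + suc f)) ((i + suc j + N) % N)                ≡⟨ cong (λ z → col (vertex (t + suc f)) ((i + suc j + (t + z)) % N)) eq ⟨
      col (vertex (t + suc f)) ((i + suc j + (t + (j + suc f))) % N) ≡⟨ cong (λ z → col (vertex (t + suc f)) (z % N)) (s₁ i j t f) ⟩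
      col (vertex (t + suc f)) ((i + (t + suc f) + suc (j + j)) % N) ≡⟨ col-step (i + (t + suc f)) (suc (j + j)) d<N ⟩
      (i + (t + suc f) + offset (suc (j + j))) % N                  ≡⟨ cong (λ z → (i + (t + suc f) + z) % N) (offset-odd j) ⟩
      (i + (t + suc f) + j) % N                                     ≡⟨ cong (_% N) (s₂ i j t f) ⟩
      (i + (t + (j + suc f))) % N                                   ≡⟨ cong (λ z → (i + (t + z)) % N) eq ⟩
      (i + N) % N                                                   ≡⟨ i+N ⟩
      i                                                             ∎
      where
      open ≡-Reasoning
      s₁ : ∀ i j t f → i + suc j + (t + (j + suc f)) ≡ i + (t + suc f) + suc (j + j)
      s₁ = solve-∀
      s₂ : ∀ i j t f → i + (t + suc f) + j ≡ i + (t + (j + suc f))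
      s₂ = solve-∀
      j<t : suc j ≤ t
      j<t = subst (suc j ≤_) (trans (sym (ℕₚ.+-suc j f)) eq) (ℕₚ.m≤m+n (suc j) f)
      d<N : suc (j + j) < N
      d<N = ℕₚ.≤-trans (s≤s (ℕₚ.≤-reflexive (sym (ℕₚ.+-suc j j)))) (ℕₚ.+-mono-≤ j<t j<t)

    -- The difference is the even number 2f with offset f + t, and tail plus offset is again i + 2t.
    zigzag-down : ∀ f j → suc j + f ≡ t → col (vertex (suc j)) (vertex (t + f)) ≡ i
    zigzag-down f j eq = begin
      col (vertex (suc j)) (vertex (t + f))                ≡⟨ cong (λ z → col (vertex (suc j)) (vertex (z + f))) eq ⟨
      col (vertex (suc j)) (vertex (suc j + f + f))        ≡⟨ cong (λ z → col (vertex (suc j)) (z % N)) (s₁ i j f) ⟩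
      col (vertex (suc j)) ((i + suc j + (f + f)) % N)     ≡⟨ col-step (i + suc j) (f + f) (ℕₚ.+-mono-< f<t f<t) ⟩
      (i + suc j + offset (f + f)) % N                     ≡⟨ cong (λ z → (i + suc j + z) % N) (offset-even f) ⟩
      (i + suc j + (f + t)) % N                            ≡⟨ cong (_% N) (s₂ i j f t) ⟩
      (i + (suc j + f + t)) % N                            ≡⟨ cong (λ z → (i + (z + t)) % N) eq ⟩
      (i + N) % N                                          ≡⟨ i+N ⟩
      i                                                    ∎
      where
      open ≡-Reasoning
      s₁ : ∀ i j f → i + (suc j + f + f) ≡ i + suc j + (f + f)
      s₁ = solve-∀
      s₂ : ∀ i j f t → i + suc j + (f + t) ≡ i + (suc j + f + t)
      s₂ = solve-∀
      f<t : f < t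
      f<t = subst (suc f ≤_) eq (s≤s (ℕₚ.m≤n+m f j))

    zigzag-last : ∀ j → suc j + 0 ≡ t → col (vertex (suc j)) N ≡ i
    zigzag-last j eq = begin
      col (vertex (suc j)) N   ≡⟨ col-to∞ (i + suc j) ⟩
      (i + suc j + t) % N      ≡⟨ cong (_% N) (ℕₚ.+-assoc i (suc j) t) ⟩
      (i + (suc j + t)) % N    ≡⟨ cong (λ z → (i + (z + t)) % N) (trans (sym (ℕₚ.+-identityʳ (suc j))) eq) ⟩
      (i + N) % N              ≡⟨ i+N ⟩
      i                        ∎
      where open ≡-Reasoning

    zigzag-linked : ∀ f j → j + suc f ≡ t →
      Linked (λ u v → col u v ≡ i) (map vertex (zigzag (suc f) j) ++ [ N ])
    zigzag-linked zero    j eq = zigzag-up 0 j eq ∷ zigzag-last j (trans (sym (ℕₚ.+-suc j 0)) eq) ∷ [-]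
    zigzag-linked (suc f) j eq = zigzag-up (suc f) j eq ∷ zigzag-down (suc f) j eq′ ∷ zigzag-linked f (suc j) eq′
      where
      eq′ : suc j + suc f ≡ t
      eq′ = trans (sym (ℕₚ.+-suc j (suc f))) eq

    cycle : ∀ {t′} → t ≡ suc t′ → HamCycle (λ u v → col u v ≡ i) (suc N) N (map vertex (zigzag t 0))
    cycle {t′} eq = hamCycle
      (Allₚ.map⁺ (All.universal (λ y e → ℕₚ.<⇒≢ (m%n<n (i + y) N) (sym e)) (zigzag t 0)) ∷
        Unique-window N i (zigzag-bounds t 0 refl) (zigzag! t 0 refl))
      (ℕₚ.≤-refl ∷ Allₚ.map⁺ (All.universal (λ y → ℕₚ.m<n⇒m<1+n (m%n<n (i + y) N)) (zigzag t 0)))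
      (cong suc (trans (Listₚ.length-map vertex (zigzag t 0)) (zigzag-length t 0)))
      (subst (λ s → Linked (λ u v → col u v ≡ i) (N ∷ map vertex (zigzag s 0) ++ [ N ])) (sym eq)
        -- An arc leaving ∞ is coloured by its head, here i + 2t, which is i modulo N.
        ((trans (col-from∞ _) (trans (cong (λ s → (i + (t + s)) % N) (sym eq)) i+N)) ∷ zigzag-linked t′ 0 (sym eq)))

  walecki : ∀ {t′} → t ≡ suc t′ → HamColouring N col
  walecki eq i = _ , _ , cycle (toℕ i) (Finₚ.toℕ<n i) eq

-- Rainbow paths in Walecki's decomposition

run : ℕ → ℕ → List ℕ
run a zero    = []
run a (suc l) = a ∷ run (2 + a) l

-- Also the last entry of `run a (suc l)`, at which the next block of a path is attached.
end : ℕ → ℕ → ℕ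
end a zero    = a
end a (suc l) = end (2 + a) l

end-+ : ∀ a l → end a l ≡ a + (l + l)
end-+ a zero    = sym (ℕₚ.+-identityʳ a)
end-+ a (suc l) = trans (end-+ (2 + a) l) (shuffle a l)
  where
  shuffle : ∀ a l → 2 + a + (l + l) ≡ a + (suc l + suc l)
  shuffle = solve-∀

run-++ : ∀ a l m → run a (l + m) ≡ run a l ++ run (end a l) m
run-++ a zero    m = refl
run-++ a (suc l) m = cong (a ∷_) (run-++ (2 + a) l m)

run-length : ∀ a l → length (run a l) ≡ l
run-length a zero    = refl
run-length a (suc l) = cong suc (run-length (2 + a) l)

run-bounds : ∀ a l → All (λ y → a ≤ y × 2 + y ≤ a + (l + l)) (run a l)
run-bounds a zero    = []
run-bounds a (suc l) = (ℕₚ.≤-refl , subst (2 + a ≤_) (shuffle a l) (ℕₚ.m≤m+n (2 + a) (l + l))) ∷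
  All.map (λ (lo , hi) → ℕₚ.≤-trans (ℕₚ.m≤n+m a 2) lo , ℕₚ.≤-trans hi (ℕₚ.≤-reflexive (shuffle a l)))
    (run-bounds (2 + a) l)
  where
  shuffle : ∀ a l → 2 + a + (l + l) ≡ a + (suc l + suc l)
  shuffle = solve-∀

run! : ∀ a l → Unique (run a l)
run! a zero    = []
run! a (suc l) = All.map (λ (lo , _) → ℕₚ.<⇒≢ (ℕₚ.<-≤-trans (ℕₚ.m<n+m a z<s) lo)) (run-bounds (2 + a) l) ∷ run! (2 + a) l

-- Entries exceed the start of their run by an even number, so a common entry would contradict the
-- hypothesis.
run-parity : ∀ a b l m → (∀ i j → a + (i + i) ≢ b + (j + j)) → ∀ {x} → x ∈ₗ run a l → x ∉ₗ run b m
run-parity a b l m a≢b x∈ x∈′ with ∈-run a l x∈ | ∈-run b m x∈′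
  where
  ∈-run : ∀ a l {x} → x ∈ₗ run a l → ∃ λ i → x ≡ a + (i + i)
  ∈-run a (suc l) (here refl) = 0 , sym (ℕₚ.+-identityʳ a)
  ∈-run a (suc l) (there x∈) with ∈-run (2 + a) l x∈
  ... | i , refl = suc i , shuffle a i
    where
    shuffle : ∀ a l → 2 + a + (l + l) ≡ a + (suc l + suc l)
    shuffle = solve-∀
... | i , refl | j , eq = a≢b i j eq

odd≢even : ∀ i j → 1 + (i + i) ≢ 2 + (j + j)
odd≢even zero    j       ()
odd≢even (suc i) zero    eq = contradiction (trans (sym (ℕₚ.+-suc i i)) (cong ℕ.pred (ℕₚ.suc-injective eq))) λ ()
odd≢even (suc i) (suc j) eq = odd≢even i j (ℕₚ.suc-injective (ℕₚ.suc-injective (trans (s₁ i) (trans eq (s₂ j)))))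
  where
  s₁ : ∀ i → 3 + (i + i) ≡ 1 + (suc i + suc i)
  s₁ = solve-∀
  s₂ : ∀ i → 2 + (suc i + suc i) ≡ 4 + (i + i)
  s₂ = solve-∀

module Rainbow (t : ℕ) .{{_ : NonZero (t + t)}} where
  open Walecki t

  private
    N : ℕ
    N = t + t
    mod : List ℕ → List ℕ
    mod = map (_% N)

  -- A full residue system, listed as odds and then evens because each run stays within one parity
  -- class.
  window : List ℕ
  window = run 1 t ++ run 2 t

  window-length : length window ≡ N
  window-length = trans (Listₚ.length-++ (run 1 t)) (cong₂ _+_ (run-length 1 t) (run-length 2 t))

  mod-window! : Unique (mod window)
  mod-window! = Unique-window N 0 
    (Allₚ.++⁺ (All.map (λ (lo , hi) → lo , ℕₚ.≤-trans (ℕₚ.n≤1+n _) (ℕₚ.≤-pred hi)) (run-bounds 1 t))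
              (All.map (λ (lo , hi) → ℕₚ.<⇒≤ lo , ℕₚ.+-cancelˡ-≤ 2 _ N hi) (run-bounds 2 t)))
    (Uniqueₚ.++⁺ (run! 1 t) (run! 2 t) λ (x∈ , x∈′) → run-parity 1 2 t t odd≢even x∈ x∈′)

  mod< : ∀ xs → All (_< N) (mod xs)
  mod< xs = Allₚ.map⁺ (All.universal (λ x → m%n<n x N) xs)

  mod! : ∀ {xs} → xs ↭ window → Unique (mod xs)
  mod! perm = Unique-resp-↭ (↭ₚ.map⁺ (_% N) (↭-sym perm)) mod-window!

  colours : List ℕ → List ℕ
  colours xs = map (uncurry col) (pairs (mod xs))

  -- The arc ∞ → p contributes the colour p. Vertices after ∞ and colours both rearrange `window`,
  -- so the path is Hamiltonian and rainbow.
  rainbow : ∀ {t′} → t ≡ suc t′ → ∀ p P C → p ∷ P ↭ window → C ↭ window → p % N ∷ colours (p ∷ P) ≡ mod C →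
    ∃ (HamColouring (suc N))
  rainbow eq p P C permP permC coloured = insertVertex (walecki eq) N (mod (p ∷ P)) z<s
    (All.map (λ x<N N≡x → ℕₚ.<⇒≢ x<N (sym N≡x)) (mod< (p ∷ P)) ∷ mod! permP)
    (ℕₚ.≤-refl ∷ All.map ℕₚ.m<n⇒m<1+n (mod< (p ∷ P)))
    (cong suc (trans (Listₚ.length-map (_% N) (p ∷ P)) (trans (↭ₚ.↭-length permP) window-length)))
    (subst Unique (sym coloured′) (mod! permC))
    (subst (All (_< N)) (sym coloured′) (mod< C))
    where
    coloured′ : col N (p % N) ∷ colours (p ∷ P) ≡ mod C
    coloured′ = trans (cong (_∷ colours (p ∷ P)) (col-from∞ (p % N))) coloured

  col-arc : ∀ x y d → d < N → x + d ≡ y → col (x % N) (y % N) ≡ (x + offset d) % N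
  col-arc x y d d<N refl = col-step x d d<N

  col-arc-wrap : ∀ x y d → d < N → x + d ≡ y + N → col (x % N) (y % N) ≡ (x + offset d) % N
  col-arc-wrap x y d d<N eq = trans (cong (col (x % N)) (sym ([m+n]%n≡m%n y N))) (col-arc x (y + N) d d<N eq)

  %-wrap : ∀ {x} y → x ≡ y + N → x % N ≡ y % N
  %-wrap y eq = trans (cong (_% N) eq) ([m+n]%n≡m%n y N)

  mod-run-wrap : ∀ a b l → a ≡ b + N → mod (run a l) ≡ mod (run b l)
  mod-run-wrap a b zero    eq = refl
  mod-run-wrap a b (suc l) eq = cong₂ _∷_ (%-wrap b eq) (mod-run-wrap (2 + a) (2 + b) l (cong (2 +_) eq))

  -- Because `offset 2` is `suc t`, steps of 2 along a run yield a run of colours shifted by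
  -- `suc t`.
  colours-run : 2 < N → ∀ a l xs → colours (run a (suc l) ++ xs) ≡ mod (run (a + suc t) l) ++ colours (end a l ∷ xs)
  colours-run 2<N a zero    xs = refl
  colours-run 2<N a (suc l) xs = cong₂ _∷_ (col-arc a (2 + a) 2 2<N (ℕₚ.+-comm a 2)) (colours-run 2<N (2 + a) l xs)

  -- Lets a colour list be checked block by block: `b` starts the run of colours modulo N, and `z`
  -- is the closed form of the vertex where the next block begins.
  extend-run : 2 < N → ∀ a l b {xs ys} z → a + (l + l) ≡ z → mod (run (a + suc t) l) ≡ mod (run b l) →
    colours (z ∷ xs) ≡ mod ys → colours (run a (suc l) ++ xs) ≡ mod (run b l ++ ys)
  extend-run 2<N a l b {xs} {ys} z end≡ shifted rest = begin
    colours (run a (suc l) ++ xs)                          ≡⟨ colours-run 2<N a l xs ⟩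
    mod (run (a + suc t) l) ++ colours (end a l ∷ xs)      ≡⟨ cong₂ _++_ shifted (cong (λ y → colours (y ∷ xs)) end≡′) ⟩
    mod (run b l) ++ colours (z ∷ xs)                      ≡⟨ cong (mod (run b l) ++_) rest ⟩
    mod (run b l) ++ mod ys                                ≡⟨ Listₚ.map-++ (_% N) (run b l) ys ⟨
    mod (run b l ++ ys)                                    ∎
    where
    open ≡-Reasoning
    end≡′ : end a l ≡ z
    end≡′ = trans (end-+ a l) end≡

run-split : ∀ a l m b {k} → l + m ≡ k → a + (l + l) ≡ b → run a k ≡ run a l ++ run b m
run-split a l m _ refl refl = trans (run-++ a l m) (cong (λ b → run a l ++ run b m) (end-+ a l))

-- The rainbow path is ∞, 6 + e, P (in evenOrder-even ∞, 3, P) and C lists its colours, both modulo N with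
-- representatives 1, …, N.  The step x → x + 2 has colour x + t + 1, so steps of 2 through one parity
-- class use up the colours of one parity; the few other steps join the classes and repair the gaps.
evenOrder-odd : ∀ s (let t = 3 + (s + s)) → ∃ (HamColouring (suc (t + t)))
evenOrder-odd s = rainbow refl (6 + e) P C permP permC
  (cong₂ _∷_ refl
    (extend-run 2<N (6 + e) s 4 (6 + (e + e)) refl (mod-run-wrap _ 4 s (s₁ e))
    -- From 6 + 2e, which is N, the path jumps by 4 to the vertex 4; `offset 4` is t + 2, so the
    -- colour is 5 + e modulo N.
    (cong₂ _∷_ (trans (col-arc-wrap (6 + (e + e)) 4 4 4<N (s₂ e)) (%-wrap (5 + e) (s₃ e)))
    (extend-run 2<N 4 s (8 + e) (4 + e) refl refl
    -- A step of 1 has offset 0, so its colour is its tail; this one passes from the even to the odd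
    -- vertices.
    (cong₂ _∷_ (trans (col-arc (4 + e) (5 + e) 1 1<N (ℕₚ.+-comm _ 1)) (cong (_% N) (ℕₚ.+-identityʳ (4 + e))))
    (extend-run 2<N (5 + e) s 3 (5 + (e + e)) refl (mod-run-wrap _ 3 s (s₄ e))
    (cong₂ _∷_ (trans (col-arc-wrap (5 + (e + e)) 1 2 2<N (s₅ e)) (%-wrap (3 + e) (s₆ e)))
    (cong₂ _∷_ (col-arc 1 2 1 1<N refl)
    (cong₂ _∷_ (col-arc 2 3 1 1<N refl)
    (extend-run 2<N 3 s (7 + e) {[]} {[]} (3 + e) refl refl refl))))))))))
  where
  e = s + s
  open Rainbow (3 + e)
  open Walecki (3 + e)
  N = (3 + e) + (3 + e)
  P C : List ℕ
  P = run (8 + e) s ++ run 4 (suc s) ++ run (5 + e) (suc s) ++ 1 ∷ 2 ∷ run 3 (suc s) ++ []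
  C = 6 + e ∷ run 4 s ++ 5 + e ∷ run (8 + e) s ++ 4 + e ∷ run 3 s ++ 3 + e ∷ 1 ∷ 2 ∷ run (7 + e) s ++ []
  4<N : 4 < N
  4<N = subst (4 <_) (r e) (ℕₚ.m≤m+n 5 (1 + (e + e)))
    where
    r : ∀ e → 5 + (1 + (e + e)) ≡ 3 + e + (3 + e)
    r = solve-∀
  2<N : 2 < N
  2<N = ℕₚ.≤-trans (s≤s (s≤s (s≤s z≤n))) 4<N
  1<N : 1 < N
  1<N = ℕₚ.≤-trans (s≤s (s≤s z≤n)) 4<N
  s₁ : ∀ e → 6 + e + (4 + e) ≡ 4 + ((3 + e) + (3 + e))
  s₁ = solve-∀
  s₂ : ∀ e → 6 + (e + e) + 4 ≡ 4 + ((3 + e) + (3 + e))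
  s₂ = solve-∀
  s₃ : ∀ e → 6 + (e + e) + (2 + (3 + e)) ≡ 5 + e + ((3 + e) + (3 + e))
  s₃ = solve-∀
  s₄ : ∀ e → 5 + e + (4 + e) ≡ 3 + ((3 + e) + (3 + e))
  s₄ = solve-∀
  s₅ : ∀ e → 5 + (e + e) + 2 ≡ 1 + ((3 + e) + (3 + e))
  s₅ = solve-∀
  s₆ : ∀ e → 5 + (e + e) + (1 + (3 + e)) ≡ 3 + e + ((3 + e) + (3 + e))
  s₆ = solve-∀
  sum₁ : ∀ s → suc s + suc s ≡ 2 + (s + s)
  sum₁ = solve-∀
  sum₂ : ∀ s → s + (2 + s) ≡ 2 + (s + s)
  sum₂ = solve-∀
  open CMSolver (↭ₚ.++-commutativeMonoid {A = ℕ}) using (solve; _⊜_; _⊕_; id)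
  -- The monoid solver sorts the blocks into odd and even vertices, and `run-split` glues adjacent
  -- runs together.
  permP : 6 + e ∷ P ↭ window
  permP = ↭-trans
    (solve 6 (λ A B C D E F → A ⊕ (B ⊕ (C ⊕ (D ⊕ (E ⊕ (F ⊕ id))))) ⊜ (D ⊕ (F ⊕ C)) ⊕ (E ⊕ (B ⊕ A))) ↭-refl
      (run (6 + e) (suc s)) (run 4 (suc s)) (run (5 + e) (suc s)) [ 1 ] [ 2 ] (run 3 (suc s)))
    (↭-reflexive (cong₂ (λ xs ys → (1 ∷ xs) ++ (2 ∷ ys))
      (sym (run-split 3 (suc s) (suc s) (5 + e) (sum₁ s) (cong (3 +_) (sum₁ s))))
      (sym (run-split 4 (suc s) (suc s) (6 + e) (sum₁ s) (cong (4 +_) (sum₁ s))))))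
  permC : C ↭ window
  permC = ↭-trans
    (solve 10 (λ A B C D E F G H I J → A ⊕ (B ⊕ (C ⊕ (D ⊕ (E ⊕ (F ⊕ (G ⊕ (H ⊕ (I ⊕ (J ⊕ id)))))))))
        ⊜ (H ⊕ (F ⊕ (G ⊕ (C ⊕ J)))) ⊕ (I ⊕ (B ⊕ (E ⊕ (A ⊕ D))))) ↭-refl
      [ 6 + e ] (run 4 s) [ 5 + e ] (run (8 + e) s) [ 4 + e ] (run 3 s) [ 3 + e ] [ 1 ] [ 2 ] (run (7 + e) s))
    (↭-reflexive (cong₂ (λ xs ys → (1 ∷ xs) ++ (2 ∷ ys))
      (sym (run-split 3 s (2 + s) (3 + e) (sum₂ s) refl))
      (sym (run-split 4 s (2 + s) (4 + e) (sum₂ s) refl))))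

evenOrder-even : ∀ s (let t = 4 + (s + s)) → ∃ (HamColouring (suc (t + t)))
evenOrder-even s = rainbow refl 3 P C permP permC
  (cong₂ _∷_ refl
    (extend-run 2<N 3 (suc s) (8 + e) (5 + e) (cong (3 +_) (sum₁ s)) refl
    -- The walk through the odd vertices makes a detour to 6 + e by two steps of 1, coloured by
    -- their tails.
    (cong₂ _∷_ (trans (col-arc (5 + e) (6 + e) 1 1<N (ℕₚ.+-comm _ 1)) (cong (_% N) (ℕₚ.+-identityʳ (5 + e))))
    (cong₂ _∷_ (trans (col-arc (6 + e) (7 + e) 1 1<N (ℕₚ.+-comm _ 1)) (cong (_% N) (ℕₚ.+-identityʳ (6 + e))))
    (extend-run 2<N (7 + e) s 4 (7 + (e + e)) refl (mod-run-wrap _ 4 s (s₁ e))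
    (cong₂ _∷_ (trans (col-arc-wrap (7 + (e + e)) 1 2 2<N (s₂ e)) (%-wrap (4 + e) (s₃ e)))
    (cong₂ _∷_ (col-arc 1 2 1 1<N refl)
    (extend-run 2<N 2 (suc s) (7 + e) (4 + e) (cong (2 +_) (sum₁ s)) refl
    -- Since 6 + e is already visited, the even walk skips it by a step of 4, whose colour is 2
    -- modulo N.
    (cong₂ _∷_ (trans (col-arc (4 + e) (8 + e) 4 4<N (ℕₚ.+-comm _ 4)) (%-wrap 2 (s₄ e)))
    (extend-run 2<N (8 + e) s 5 {[]} {[]} (8 + (e + e)) refl (mod-run-wrap _ 5 s (s₅ e)) refl))))))))))
  where
  e = s + s
  open Rainbow (4 + e)
  open Walecki (4 + e)
  N = (4 + e) + (4 + e)
  P C : List ℕ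
  P = run 5 (suc s) ++ 6 + e ∷ run (7 + e) (suc s) ++ 1 ∷ run 2 (2 + s) ++ run (8 + e) (suc s) ++ []
  C = 3 ∷ run (8 + e) (suc s) ++ 5 + e ∷ 6 + e ∷ run 4 s ++ 4 + e ∷ 1 ∷ run (7 + e) (suc s) ++ 2 ∷ run 5 s ++ []
  4<N : 4 < N
  4<N = subst (4 <_) (r e) (ℕₚ.m≤m+n 5 (3 + (e + e)))
    where
    r : ∀ e → 5 + (3 + (e + e)) ≡ 4 + e + (4 + e)
    r = solve-∀
  2<N : 2 < N
  2<N = ℕₚ.≤-trans (s≤s (s≤s (s≤s z≤n))) 4<N
  1<N : 1 < N
  1<N = ℕₚ.≤-trans (s≤s (s≤s z≤n)) 4<N
  s₁ : ∀ e → 7 + e + (5 + e) ≡ 4 + ((4 + e) + (4 + e))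
  s₁ = solve-∀
  s₂ : ∀ e → 7 + (e + e) + 2 ≡ 1 + ((4 + e) + (4 + e))
  s₂ = solve-∀
  s₃ : ∀ e → 7 + (e + e) + (1 + (4 + e)) ≡ 4 + e + ((4 + e) + (4 + e))
  s₃ = solve-∀
  s₄ : ∀ e → 4 + e + (2 + (4 + e)) ≡ 2 + ((4 + e) + (4 + e))
  s₄ = solve-∀
  s₅ : ∀ e → 8 + e + (5 + e) ≡ 5 + ((4 + e) + (4 + e))
  s₅ = solve-∀
  sum₁ : ∀ s → suc s + suc s ≡ 2 + (s + s)
  sum₁ = solve-∀
  sum₂ : ∀ s k → s + (k + s) ≡ k + (s + s)
  sum₂ = solve-∀
  double : ∀ s → (2 + s) + (2 + s) ≡ 4 + (s + s)
  double = solve-∀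
  open CMSolver (↭ₚ.++-commutativeMonoid {A = ℕ}) using (solve; _⊜_; _⊕_; id)
  permP : 3 ∷ P ↭ window
  permP = ↭-trans
    (solve 6 (λ A B C D E F → A ⊕ (B ⊕ (C ⊕ (D ⊕ (E ⊕ (F ⊕ id))))) ⊜ (D ⊕ (A ⊕ C)) ⊕ (E ⊕ (B ⊕ F))) ↭-refl
      (run 3 (2 + s)) [ 6 + e ] (run (7 + e) (suc s)) [ 1 ] (run 2 (2 + s)) (run (8 + e) (suc s)))
    (↭-reflexive (cong₂ (λ xs ys → (1 ∷ xs) ++ ys)
      (sym (run-split 3 (2 + s) (suc s) (7 + e) (cong suc (sum₁ s)) (cong (3 +_) (double s))))
      (sym (run-split 2 (2 + s) (2 + s) (6 + e) (double s) (cong (2 +_) (double s))))))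
  permC : C ↭ window
  permC = ↭-trans
    (solve 10 (λ A B C D E F G H I J → A ⊕ (B ⊕ (C ⊕ (D ⊕ (E ⊕ (F ⊕ (G ⊕ (H ⊕ (I ⊕ (J ⊕ id)))))))))
        ⊜ (G ⊕ (A ⊕ (J ⊕ (C ⊕ H)))) ⊕ (I ⊕ (E ⊕ (F ⊕ (D ⊕ B))))) ↭-refl
      [ 3 ] (run (8 + e) (suc s)) [ 5 + e ] [ 6 + e ] (run 4 s) [ 4 + e ] [ 1 ] (run (7 + e) (suc s)) [ 2 ] (run 5 s))
    (↭-reflexive (cong₂ (λ xs ys → (1 ∷ 3 ∷ xs) ++ (2 ∷ ys))
      (sym (run-split 5 s (2 + s) (5 + e) (sum₂ s 2) refl))
      (sym (run-split 4 s (3 + s) (4 + e) (sum₂ s 3) refl))))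

-- The extremal values

parity : ∀ m → ∃ λ h → m ≡ h + h ⊎ m ≡ suc (h + h)
parity zero    = 0 , inj₁ refl
parity (suc m) with parity m
... | h , inj₁ refl = h , inj₂ refl
... | h , inj₂ refl = suc h , inj₁ (cong suc (sym (ℕₚ.+-suc h h)))

-- For an even number of colours this is Walecki's decomposition. For an odd number a vertex is
-- inserted, and the parity of t = 3 + h selects the rainbow path.
tillson : ∀ m → ∃ (HamColouring (6 + m))
tillson m with parity m
... | h , inj₁ refl = subst (λ N → ∃ (HamColouring N)) (order h) (_ , Walecki.walecki (3 + h) refl)
  where
  order : ∀ h → 3 + h + (3 + h) ≡ 6 + (h + h)
  order = solve-∀
... | h , inj₂ refl = subst (λ N → ∃ (HamColouring N)) (order h) (byParity h (parity h))
  where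
  order : ∀ h → suc (3 + h + (3 + h)) ≡ 7 + (h + h)
  order = solve-∀
  byParity : ∀ h → (∃ λ s → h ≡ s + s ⊎ h ≡ suc (s + s)) → ∃ (HamColouring (suc (3 + h + (3 + h))))
  byParity _ (s , inj₁ refl) = evenOrder-odd s
  byParity _ (s , inj₂ refl) = evenOrder-even s

-- The two sides differ by the square of a - b; the case split keeps this difference a natural
-- number.
4*a*b≤[a+b]² : ∀ a b → a * b * 4 ≤ (a + b) * (a + b)
4*a*b≤[a+b]² a b with ℕₚ.≤-total a b
... | inj₁ a≤b = subst (λ b → a * b * 4 ≤ (a + b) * (a + b)) (ℕₚ.m+[n∸m]≡n a≤b)
  (subst (a * (a + d) * 4 ≤_) (expand a d) (ℕₚ.m≤m+n _ (d * d)))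
  where
  d = b ∸ a
  expand : ∀ a d → a * (a + d) * 4 + d * d ≡ (a + (a + d)) * (a + (a + d))
  expand = solve-∀
... | inj₂ b≤a = subst (λ a → a * b * 4 ≤ (a + b) * (a + b)) (ℕₚ.m+[n∸m]≡n b≤a)
  (subst ((b + d) * b * 4 ≤_) (expand b d) (ℕₚ.m≤m+n _ (d * d)))
  where
  d = a ∸ b
  expand : ∀ b d → (b + d) * b * 4 + d * d ≡ (b + d + b) * (b + d + b)
  expand = solve-∀

product-bound : ∀ {a b N} → a + b ≤ N → a * b ≤ (N * N) / 4
product-bound {a} {b} {N} a+b≤N = begin
  a * b              ≡⟨ m*n/n≡m (a * b) 4 ⟨
  (a * b * 4) / 4    ≤⟨ /-monoˡ-≤ 4 (ℕₚ.≤-trans (4*a*b≤[a+b]² a b) (ℕₚ.*-mono-≤ a+b≤N a+b≤N)) ⟩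
  (N * N) / 4        ∎
  where open ℕₚ.≤-Reasoning

-- For N = 2h + 1 the square is 4h(h + 1) + 1, and the floor drops the 1.
balanced : ∀ N → ∃₂ λ a b → a + b ≡ N × a * b ≡ (N * N) / 4
balanced N with parity N
... | h , inj₁ refl = h , h , refl , trans (sym (m*n/n≡m (h * h) 4)) (cong (_/ 4) (square h))
  where
  square : ∀ h → h * h * 4 ≡ (h + h) * (h + h)
  square = solve-∀
... | h , inj₂ refl = h , suc h , ℕₚ.+-suc h h , (begin
  h * suc h                    ≡⟨ m*n/n≡m (h * suc h) 4 ⟨
  (h * suc h * 4) / 4          ≡⟨ +-distrib-/-∣ʳ 1 {d = 4} (n∣m*n (h * suc h)) ⟨
  (1 + h * suc h * 4) / 4      ≡⟨ cong (_/ 4) (square h) ⟩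
  (suc (h + h) * suc (h + h)) / 4 ∎)
  where
  open ≡-Reasoning
  square : ∀ h → 1 + h * suc h * 4 ≡ suc (h + h) * suc (h + h)
  square = solve-∀

-- Extremal digraphs and the final bounds

outStar : ∀ n → Digraph (suc n)
arc      (outStar n) zero    (suc _) = true
arc      (outStar n) zero    zero    = false
arc      (outStar n) (suc _) _       = false
loopless (outStar n) zero    = refl
loopless (outStar n) (suc _) = refl

sink⇒isLambdaK-0 : ∀ {k} → 2 ≤ k → k ≤ n → (D : Digraph n) (r : Fin n) → (∀ v → ¬ T (arc D r v)) → IsLambdaK D k 0
sink⇒isLambdaK-0 2≤k k≤n D r sink with subsetOfSize∋ r _ (ℕₚ.<⇒≤ 2≤k) k≤n
... | S , ∣S∣ , r∈S = isMinPacking⇒isLambdaK D ((λ _ _ _ _ → (λ ()) , (λ ()) , λ ()) , S , r , ∣S∣ , r∈S ,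
  λ (_ , isP , _) → let v , rv , _ = firstArc D (subst (2 ≤_) (sym ∣S∣) 2≤k) r∈S (isP zero) in sink v rv)

isLambdaK-exists : ∀ {k} → 2 ≤ k → k ≤ n → (D : Digraph n) → Σ ℕ (IsLambdaK D k)
isLambdaK-exists 2≤k k≤n D with isMinPacking 2≤k k≤n D
... | m , min = m , isMinPacking⇒isLambdaK D min

-- Any value satisfying `IsLambdaK` is at most the one given by `isMinPacking`, which is all that an
-- upper bound requires.
isLambdaK-sum : ∀ {k} → 2 ≤ k → k ≤ n → (D : Digraph n) → ∀ {a b} →
  IsLambdaK D k a → IsLambdaK (D ᶜ) k b → a + b < n
isLambdaK-sum 2≤k k≤n D λa λb with isMinPacking 2≤k k≤n D | isMinPacking 2≤k k≤n (D ᶜ)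
... | _ , mina | _ , minb = ℕₚ.≤-<-trans
  (ℕₚ.+-mono-≤ (isLambdaK-≤ D mina λa) (isLambdaK-≤ (D ᶜ) minb λb))
  (isMinPacking-sum 2≤k k≤n D mina minb)

outStar-isLambdaK : ∀ {m k} → 2 ≤ k → k ≤ 2 + m →
  IsLambdaK (outStar (suc m)) k 0 × IsLambdaK (outStar (suc m) ᶜ) k 0
outStar-isLambdaK {m} 2≤k k≤n =
  sink⇒isLambdaK-0 2≤k k≤n (outStar (suc m)) (suc zero) (λ _ ()) ,
  sink⇒isLambdaK-0 2≤k k≤n (outStar (suc m) ᶜ) zero (λ { zero () ; (suc _) () })

balanced-isLambdaK : ∀ {N k} → 6 ≤ N → 2 ≤ k → k ≤ suc N →
  Σ (Digraph (suc N)) λ D → Σ ℕ λ a → Σ ℕ λ b →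
    IsLambdaK D k a × IsLambdaK (D ᶜ) k b × a + b ≡ N × a * b ≡ (N * N) / 4
balanced-isLambdaK {N} 6≤N 2≤k k≤n
  with balanced N | subst (λ N → ∃ (HamColouring N)) (ℕₚ.m+[n∸m]≡n 6≤N) (tillson (N ∸ 6))
... | a , b , a+b≡N , a*b≡ | _ , ham with decomposition⇒sharp 2≤k k≤n ham a b a+b≡N
...   | D , λa , λb = D , a , b , λa , λb , a+b≡N , a*b≡

theorem3p4 : ∀ (n : ℕ) → 7 ≤ n → ∀ (k : ℕ) → 2 ≤ k → k ≤ n →
    ((D : Digraph n) → Σ ℕ (IsLambdaK D k) × Σ ℕ (IsLambdaK (D ᶜ) k)) ×
    ((D : Digraph n) → ∀ a b → IsLambdaK D k a → IsLambdaK (D ᶜ) k b →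
    (a + b ≤ n ∸ 1) × (a * b ≤ ((n ∸ 1) * (n ∸ 1)) / 4)) ×
    (Σ (Digraph n) λ D → Σ ℕ λ a → Σ ℕ λ b →
    IsLambdaK D k a × IsLambdaK (D ᶜ) k b × a + b ≡ 0) ×
    (Σ (Digraph n) λ D → Σ ℕ λ a → Σ ℕ λ b →
    IsLambdaK D k a × IsLambdaK (D ᶜ) k b × a + b ≡ n ∸ 1) ×
    (Σ (Digraph n) λ D → Σ ℕ λ a → Σ ℕ λ b →
    IsLambdaK D k a × IsLambdaK (D ᶜ) k b × a * b ≡ 0) ×
    (Σ (Digraph n) λ D → Σ ℕ λ a → Σ ℕ λ b →
    IsLambdaK D k a × IsLambdaK (D ᶜ) k b × a * b ≡ ((n ∸ 1) * (n ∸ 1)) / 4)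
theorem3p4 (suc N@(suc m)) (s≤s 6≤N) k 2≤k k≤n
  with outStar-isLambdaK {m} 2≤k k≤n | balanced-isLambdaK 6≤N 2≤k k≤n
... | λ₀ , λ₀ᶜ | D , a , b , λa , λb , a+b≡ , a*b≡ =
  (λ D → isLambdaK-exists 2≤k k≤n D , isLambdaK-exists 2≤k k≤n (D ᶜ)) ,
  (λ D a b λa λb → let a+b≤N = ℕₚ.≤-pred (isLambdaK-sum 2≤k k≤n D λa λb) in
    a+b≤N , product-bound {a} {b} a+b≤N) ,
  (outStar N , 0 , 0 , λ₀ , λ₀ᶜ , refl) ,
  (D , a , b , λa , λb , a+b≡) ,
  (outStar N , 0 , 0 , λ₀ , λ₀ᶜ , refl) ,
  (D , a , b , λa , λb , a*b≡)
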